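{- \begin{enumerate} \item $\mathrm{MILL}1$ is sound w.r.t. hypergraph language models. \item $\mathrm{MILL}1(\multimap,\forall)$ is complete w.r.t. hypergraph language models. \end{enumerate}
   Context: $\mathrm{MILL}1$ is first-order multiplicative intuitionistic linear logic (connectives $\otimes,\multimap$, quantifiers $\exists,\forall$, atomic formulae $p(x_1,\dots,x_n)$ with variables only, no function symbols or constants), with sequents $\Gamma\vdash B$, $\Gamma$ a multiset; $\mathrm{MILL}1(\multimap,\forall)$ is its fragment using only $\multimap$ and $\forall$. Selectors and variables are identified: $\Sigma=\mathrm{Var}$. A hypergraph $H$ over a $\Sigma$-typed alphabet $T$ has nodes $V_H$, hyperedges $E_H$ labelled by $T$, attachment functions $\mathit{att}_H(e):\mathrm{type}(\mathit{lab}_H(e))\to V_H$ and external-node function $\mathit{ext}_H:\mathrm{type}(H)\to V_H$; $K_0$ is the empty hypergraph. Parallel composition $H_1 \mathbin{/\!/} H_2$: disjoint union of $H_1,H_2$ with $\mathit{ext}_{H_1}(\sigma)$ and $\mathit{ext}_{H_2}(\sigma)$ fused for $\sigma\in\mathrm{type}(H_1)\cap\mathrm{type}(H_2)$; type $\mathrm{type}(H_1)\cup\mathrm{type}(H_2)$. Substitution $\mathit{sub}_h(H)$ for partial $h:\Sigma\to\Sigma$ fuses external nodes whose selectors have equal $h$-images and renames selectors via $h$ (selectors with undefined $h$ become non-external). A hypergraph language model is $\langle T,u\rangle$ with $u$ mapping $\mathrm{MILL}1$ formulae to sets of abstract hypergraphs over $T$ such that: $\mathit{sub}_h(u(A))\subseteq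 u(A[h])$ for any total $h:\Sigma\to\Sigma$; $u(A\otimes B)=u(A)\mathbin{/\!/} u(B)$; $u(A\multimap B)=\{H\mid\forall H'\in u(A)\,(H\mathbin{/\!/} H'\in u(B))\}$; $u(\exists xA)=\bigcup_{y}u(A[y/x])$; $u(\forall xA)=\bigcap_y u(A[y/x])$. A sequent $A_1,\ldots,A_n\vdash B$ is true in the model if $u(A_1)\mathbin{/\!/}\cdots\mathbin{/\!/} u(A_n)\subseteq u(B)$ (for $n=0$: $K_0\in u(B)$). -}

module Defs where

open import Data.Nat using (ℕ; zero; suc; _≤_)
open import Data.Fin using (Fin; zero; suc)
open import Data.Bool using (Bool; true; false)
open import Data.Maybe using (Maybe; just; nothing; is-just)
import Data.Maybe as Maybe
open import Data.List using (List; []; _∷_; _++_)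
open import Data.List.Relation.Unary.Any using (Any)
open import Data.List.Relation.Binary.Permutation.Propositional using (_↭_)
open import Data.Sum using (_⊎_; inj₁; inj₂)
open import Data.Product using (Σ; ∃; _×_; _,_)
open import Data.Empty using (⊥)
open import Function using (_∘_)
open import Function.Bundles using (_↔_; _⇔_; Inverse)
open import Relation.Nullary using (¬_)
open import Relation.Binary.PropositionalEquality using (_≡_)
open import Relation.Binary.Construct.Closure.Equivalence using (EqClosure)

-- Syntax of MILL1 (locally nameless: free variables = names in ℕ = Σ,
-- bound variables = de Bruijn indices, intrinsically scoped).

data Term (k : ℕ) : Set where
  free  : ℕ → Term k
  bound : Fin k → Term k

data Formula (k : ℕ) : Set where
  atom : ℕ → List (Term k) → Formula k
  _⊗_  : Formula k → Formula k → Formula k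
  _⊸_  : Formula k → Formula k → Formula k
  ex   : Formula (suc k) → Formula k
  all  : Formula (suc k) → Formula k

infixr 6 _⊗_
infixr 5 _⊸_

weakenT : ∀ {j} → Term j → Term (suc j)
weakenT (free x)  = free x
weakenT (bound i) = bound (suc i)

liftS : ∀ {k j} → (Fin k → Term j) → Fin (suc k) → Term (suc j)
liftS s zero    = bound zero
liftS s (suc i) = weakenT (s i)

subT : ∀ {k j} → (Fin k → Term j) → Term k → Term j
subT s (free x)  = free x
subT s (bound i) = s i

subF : ∀ {k j} → (Fin k → Term j) → Formula k → Formula j
subF s (atom p xs) = atom p (Data.List.map (subT s) xs)
subF s (A ⊗ B) = subF s A ⊗ subF s B
subF s (A ⊸ B) = subF s A ⊸ subF s B
subF s (ex A)  = ex (subF (liftS s) A)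
subF s (all A) = all (subF (liftS s) A)

openS : ∀ {k} → ℕ → Fin (suc k) → Term k
openS y zero    = free y
openS y (suc i) = bound i

inst : ∀ {k} → Formula (suc k) → ℕ → Formula k
inst A y = subF (openS y) A

renT : ∀ {k} → (ℕ → ℕ) → Term k → Term k
renT h (free x)  = free (h x)
renT h (bound i) = bound i

ren : ∀ {k} → (ℕ → ℕ) → Formula k → Formula k
ren h (atom p xs) = atom p (Data.List.map (renT h) xs)
ren h (A ⊗ B) = ren h A ⊗ ren h B
ren h (A ⊸ B) = ren h A ⊸ ren h B
ren h (ex A)  = ex (ren h A)
ren h (all A) = all (ren h A)

data FreeIn (y : ℕ) {k : ℕ} : Formula k → Set where
  atomF : ∀ {p xs} → Any (_≡_ (free y)) xs → FreeIn y (atom p xs)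
  ⊗ˡ : ∀ {A B} → FreeIn y A → FreeIn y (A ⊗ B)
  ⊗ʳ : ∀ {A B} → FreeIn y B → FreeIn y (A ⊗ B)
  ⊸ˡ : ∀ {A B} → FreeIn y A → FreeIn y (A ⊸ B)
  ⊸ʳ : ∀ {A B} → FreeIn y B → FreeIn y (A ⊸ B)
  exF  : ∀ {A} → FreeIn y A → FreeIn y (ex A)
  allF : ∀ {A} → FreeIn y A → FreeIn y (all A)

FreeInCtx : ℕ → List (Formula 0) → Set
FreeInCtx y Γ = Any (FreeIn y) Γ

data ImpAll {k : ℕ} : Formula k → Set where
  atomI : ∀ {p xs} → ImpAll (atom p xs)
  ⊸I : ∀ {A B} → ImpAll A → ImpAll B → ImpAll (A ⊸ B)
  allI : ∀ {A} → ImpAll A → ImpAll (all A)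

infix 3 _⊢_
data _⊢_ : List (Formula 0) → Formula 0 → Set where
  ax   : ∀ {A} → (A ∷ []) ⊢ A
  cut  : ∀ {Γ Δ A C} → Γ ⊢ A → (A ∷ Δ) ⊢ C → (Γ ++ Δ) ⊢ C
  exch : ∀ {Γ Δ C} → Γ ↭ Δ → Γ ⊢ C → Δ ⊢ C
  ⊗L   : ∀ {Γ A B C} → (A ∷ B ∷ Γ) ⊢ C → ((A ⊗ B) ∷ Γ) ⊢ C
  ⊗R   : ∀ {Γ Δ A B} → Γ ⊢ A → Δ ⊢ B → (Γ ++ Δ) ⊢ A ⊗ B
  ⊸L   : ∀ {Γ Δ A B C} → Γ ⊢ A → (B ∷ Δ) ⊢ C → ((A ⊸ B) ∷ Γ ++ Δ) ⊢ C
  ⊸R   : ∀ {Γ A B} → (A ∷ Γ) ⊢ B → Γ ⊢ A ⊸ B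
  ∃L   : ∀ {Γ A C} y → (inst A y ∷ Γ) ⊢ C →
         ¬ FreeInCtx y Γ → ¬ FreeIn y C → ¬ FreeIn y A → (ex A ∷ Γ) ⊢ C
  ∃R   : ∀ {Γ A} y → Γ ⊢ inst A y → Γ ⊢ ex A
  ∀L   : ∀ {Γ A C} y → (inst A y ∷ Γ) ⊢ C → (all A ∷ Γ) ⊢ C
  ∀R   : ∀ {Γ A} y → Γ ⊢ inst A y →
         ¬ FreeInCtx y Γ → ¬ FreeIn y A → Γ ⊢ all A

-- Hypergraphs over a Σ-typed alphabet (Σ = Var = ℕ)

FiniteSet : (ℕ → Bool) → Set
FiniteSet S = ∃ λ b → ∀ σ → b ≤ σ → S σ ≡ false

record Alphabet : Set₁ where
  field
    Lab     : Set
    type    : Lab → ℕ → Bool          -- type(a) ⊆ Σ as characteristic function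
    typeFin : ∀ a → FiniteSet (type a)

open Alphabet public

record Hypergraph (T : Alphabet) : Set where
  field
    nV  : ℕ
    nE  : ℕ
    lab : Fin nE → Lab T
    att : Fin nE → ℕ → Maybe (Fin nV)    -- att(e) : type(lab e) → V_H
    att-dom : ∀ e σ → is-just (att e σ) ≡ type T (lab e) σ
    ext : ℕ → Maybe (Fin nV)             -- ext : type(H) → V_H, type(H) = dom ext
    ext-fin : FiniteSet (is-just ∘ ext)

open Hypergraph public

module _ {T : Alphabet} where

  -- isomorphism of hypergraphs (abstract hypergraph = iso class)
  record Iso (H H' : Hypergraph T) : Set where
    field
      fV : Fin (nV H) ↔ Fin (nV H')
      fE : Fin (nE H) ↔ Fin (nE H')
      lab-pres : ∀ e → lab H' (Inverse.to fE e) ≡ lab H e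
      att-pres : ∀ e σ → att H' (Inverse.to fE e) σ ≡ Maybe.map (Inverse.to fV) (att H e σ)
      ext-pres : ∀ σ → ext H' σ ≡ Maybe.map (Inverse.to fV) (ext H σ)

  IsEmpty : Hypergraph T → Set
  IsEmpty H = (nV H ≡ 0) × (nE H ≡ 0) × (∀ σ → ext H σ ≡ nothing)

  data ParGlue (H₁ H₂ : Hypergraph T) : Fin (nV H₁) ⊎ Fin (nV H₂) → Fin (nV H₁) ⊎ Fin (nV H₂) → Set where
    glue : ∀ σ a b → ext H₁ σ ≡ just a → ext H₂ σ ≡ just b → ParGlue H₁ H₂ (inj₁ a) (inj₂ b)

  -- Par H₁ H₂ H : H is (isomorphic to) H₁ // H₂
  record Par (H₁ H₂ H : Hypergraph T) : Set where
    field
      g : Fin (nV H₁) ⊎ Fin (nV H₂) → Fin (nV H)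
      g-surj : ∀ v → ∃ λ x → g x ≡ v
      g-ker : ∀ x y → (g x ≡ g y) ⇔ EqClosure (ParGlue H₁ H₂) x y
      k : (Fin (nE H₁) ⊎ Fin (nE H₂)) ↔ Fin (nE H)
      lab₁ : ∀ e → lab H (Inverse.to k (inj₁ e)) ≡ lab H₁ e
      lab₂ : ∀ e → lab H (Inverse.to k (inj₂ e)) ≡ lab H₂ e
      att₁ : ∀ e σ → att H (Inverse.to k (inj₁ e)) σ ≡ Maybe.map (g ∘ inj₁) (att H₁ e σ)
      att₂ : ∀ e σ → att H (Inverse.to k (inj₂ e)) σ ≡ Maybe.map (g ∘ inj₂) (att H₂ e σ)
      ext₁ : ∀ σ v → ext H₁ σ ≡ just v → ext H σ ≡ just (g (inj₁ v))
      ext₂ : ∀ σ v → ext H₂ σ ≡ just v → ext H σ ≡ just (g (inj₂ v))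
      extN : ∀ σ → ext H₁ σ ≡ nothing → ext H₂ σ ≡ nothing → ext H σ ≡ nothing

  data SubGlue (h : ℕ → ℕ) (H : Hypergraph T) : Fin (nV H) → Fin (nV H) → Set where
    glue : ∀ σ τ a b → ext H σ ≡ just a → ext H τ ≡ just b → h σ ≡ h τ → SubGlue h H a b

  -- Sub h H H' : H' is (isomorphic to) sub_h(H)
  record Sub (h : ℕ → ℕ) (H H' : Hypergraph T) : Set where
    field
      g : Fin (nV H) → Fin (nV H')
      g-surj : ∀ v → ∃ λ x → g x ≡ v
      g-ker : ∀ x y → (g x ≡ g y) ⇔ EqClosure (SubGlue h H) x y
      k : Fin (nE H) ↔ Fin (nE H')
      lab-pres : ∀ e → lab H' (Inverse.to k e) ≡ lab H e
      att-pres : ∀ e σ → att H' (Inverse.to k e) σ ≡ Maybe.map g (att H e σ)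
      ext-img : ∀ σ v → ext H σ ≡ just v → ext H' (h σ) ≡ just (g v)
      ext-dom : ∀ ρ w → ext H' ρ ≡ just w → ∃ λ σ → (h σ ≡ ρ) × (∃ λ v → ext H σ ≡ just v)

  Lang : Set₁
  Lang = Hypergraph T → Set

  _∥_ : Lang → Lang → Lang
  (L₁ ∥ L₂) H = ∃ λ H₁ → ∃ λ H₂ → L₁ H₁ × L₂ H₂ × Par H₁ H₂ H

record Model (T : Alphabet) : Set₁ where
  field
    u : Formula 0 → Lang {T}
    iso-closed : ∀ A {H H'} → Iso H H' → u A H → u A H'
    sub-incl : ∀ (h : ℕ → ℕ) A {H H'} → u A H → Sub h H H' → u (ren h A) H'
    u-⊗ : ∀ A B H → u (A ⊗ B) H ⇔ (u A ∥ u B) H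
    u-⊸ : ∀ A B H → u (A ⊸ B) H ⇔ (∀ H' K → u A H' → Par H H' K → u B K)
    u-∃ : ∀ A H → u (ex A) H ⇔ (∃ λ y → u (inst A y) H)
    u-∀ : ∀ A H → u (all A) H ⇔ (∀ y → u (inst A y) H)

open Model public

uCtx : ∀ {T} → Model T → List (Formula 0) → Lang {T}
uCtx M []          = IsEmpty
uCtx M (A ∷ [])    = u M A
uCtx M (A ∷ B ∷ Γ) = u M A ∥ uCtx M (B ∷ Γ)

TrueIn : ∀ {T} → Model T → List (Formula 0) → Formula 0 → Set
TrueIn M Γ B = ∀ H → uCtx M Γ H → u M B H

module Submission where

open import Defs
import Data.Maybe as Maybe
import Data.Sum.Properties as Sum
import Data.Vec.Properties as Vec
open import Data.Nat.Properties using () renaming (_≟_ to _≟ℕ_)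
open import Data.Bool using (true; false)
open import Data.Empty using (⊥; ⊥-elim)
open import Data.Fin using (Fin; zero; suc; toℕ; fromℕ<; splitAt; _↑ˡ_; _↑ʳ_; punchIn)
open import Data.Fin.Permutation using (remove; punchIn-permute)
open import Data.Fin.Properties using (toℕ-fromℕ<; _≟_; suc-injective; +↔⊎; splitAt-join; any?; toℕ<n; fromℕ<-toℕ; splitAt-↑ˡ; splitAt-↑ʳ; splitAt⁻¹-↑ˡ; splitAt⁻¹-↑ʳ)
open import Data.List using (List; []; _∷_; map; _++_; tabulate)
open import Data.List.Properties using (map-∘; map-cong; map-++; tabulate-cong; ++-identityʳ; map-id)
open import Data.List.Relation.Binary.Permutation.Propositional as Perm using (_↭_; ↭-sym; ↭-reflexive)
open import Data.List.Relation.Binary.Permutation.Propositional.Properties using (map⁺; ++-comm)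
open import Data.List.Relation.Unary.All using (All; []; _∷_)
open import Data.List.Relation.Unary.Any using (Any; here; there)
open import Data.Maybe using (Maybe; just; nothing; is-just)
open import Data.Maybe.Properties using (just-injective; ≡-dec)
open import Data.Nat using (ℕ; zero; suc; _≤_; _<_; _⊔_; _<?_; _+_; _∸_)
open import Data.Nat.Properties using (≤-trans; m≤m⊔n; m≤n⊔m; <⇒≱; m≤n⇒m<n∨m≡n; ≤-pred; ≮⇒≥; m+n∸m≡n; ∸-monoˡ-≤; m≤m+n)
open import Data.Product using (Σ; ∃; _×_; _,_; proj₁; proj₂)
open import Data.Sum using (_⊎_; inj₁; inj₂; [_,_]; swap)
open import Data.Sum.Algebra using (⊎-comm; ⊎-assoc)
open import Data.Sum.Function.Propositional using (_⊎-↔_)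
open import Data.Sum.Properties using (inj₁-injective; inj₂-injective)
open import Data.Vec as Vec using (Vec; []; _∷_; lookup)
open import Function using (_∘_; id)
open import Function.Bundles using (_↔_; _⇔_; Inverse; Equivalence; mk⇔; mk↔ₛ′)
open import Function.Construct.Composition using (_↔-∘_)
open import Function.Construct.Identity using (↔-id)
open import Function.Construct.Symmetry using (↔-sym)
open import Level using (0ℓ)
open import Relation.Binary using (DecidableEquality; IsEquivalence)
open import Relation.Binary.Construct.Closure.Equivalence as EC using (EqClosure)
open import Relation.Binary.PropositionalEquality hiding ([_])
open import Relation.Nullary using (¬_; yes; no; Dec; does)
open import Relation.Nullary.Decidable using (dec-true; dec-false; ¬?; _⊎-dec_)

-- Soundness is proved for all renamings of a derivable sequent at once, so that the
-- eigenvariable rules only have to reuse the premise under a modified renaming.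
--
-- For completeness, hyperedges are labelled by formulas whose bound variables are the
-- selectors, so that a hypergraph whose external nodes are denoted by names is a
-- multiset of formulas with its internal nodes as bound variables. An atom holds in
-- such a hypergraph if it is derivable from all instances of this multiset. The other
-- connectives are interpreted by a forcing relation that quantifies over later
-- renamings. For ⊸ and all this quantification is redundant in the language model, as
-- any renaming can be absorbed into a suitable choice of external selectors, but it
-- makes the inclusion for sub_h hold for all formulas of MILL1. On the fragment with
-- ⊸ and all, forcing coincides with derivability from all instances.

-- Simultaneous substitution

-- Derivability cannot interpret every connective. A single hyperedge labelled `A ⊗ B` derives
-- `A ⊗ B`, yet in general its hypergraph does not split into a part deriving `A` and a part
-- deriving `B`. Hence only atoms refer to derivability, and forcing is compared with it on the
-- fragment alone, whose right rules are invertible. Three features of hypergraphs shape the rest.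
-- Parallel composition is a relation between representatives, so associativity in the soundness
-- proof needs composites to exist, and the quotient of the nodes has to be computed. A node may
-- have several selectors, and a formula may mention selectors that the hypergraph lacks; choosing
-- one selector per external node turns equality of nodes into equality of names. Substitution and
-- gluing fuse external nodes but never internal ones, so morphisms rename names arbitrarily and are
-- injective on internal nodes. Finiteness of `type(H)` supplies the fresh selectors through which ⊸
-- and `all` simulate renamings.

sub₂T : ∀ {k j} → (ℕ → Term j) → (Fin k → Term j) → Term k → Term j
sub₂T f s (free x)  = f x
sub₂T f s (bound i) = s i

-- `subF`, `ren` and `⟦_⟧` are all instances, so one composition law covers their interplay. Free
-- names may also be sent to bound variables, which `abstractF` relies on.
sub₂ : ∀ {k j} → (ℕ → Term j) → (Fin k → Term j) → Formula k → Formula j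
sub₂ f s (atom p xs) = atom p (map (sub₂T f s) xs)
sub₂ f s (A ⊗ B) = sub₂ f s A ⊗ sub₂ f s B
sub₂ f s (A ⊸ B) = sub₂ f s A ⊸ sub₂ f s B
sub₂ f s (ex A)  = ex (sub₂ (weakenT ∘ f) (liftS s) A)
sub₂ f s (all A) = all (sub₂ (weakenT ∘ f) (liftS s) A)

liftS-cong : ∀ {k j} {s s' : Fin k → Term j} → s ≗ s' → liftS s ≗ liftS s'
liftS-cong e zero    = refl
liftS-cong e (suc i) = cong weakenT (e i)

sub₂Ts-cong : ∀ {k j} {f f' : ℕ → Term j} {s s' : Fin k → Term j} (xs : List (Term k)) →
              (∀ x → Any (_≡_ (free x)) xs → f x ≡ f' x) → s ≗ s' →
              map (sub₂T f s) xs ≡ map (sub₂T f' s') xs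
sub₂Ts-cong []             e e' = refl
sub₂Ts-cong (free x ∷ xs)  e e' =
  cong₂ _∷_ (e x (here refl)) (sub₂Ts-cong xs (λ y → e y ∘ there) e')
sub₂Ts-cong (bound i ∷ xs) e e' =
  cong₂ _∷_ (e' i) (sub₂Ts-cong xs (λ y → e y ∘ there) e')

sub₂-cong : ∀ {k j} {f f' : ℕ → Term j} {s s' : Fin k → Term j} (A : Formula k) →
            (∀ x → FreeIn x A → f x ≡ f' x) → s ≗ s' → sub₂ f s A ≡ sub₂ f' s' A
sub₂-cong (atom p xs) e e' = cong (atom p) (sub₂Ts-cong xs (λ x → e x ∘ atomF) e')
sub₂-cong (A ⊗ B) e e' =
  cong₂ _⊗_ (sub₂-cong A (λ x → e x ∘ ⊗ˡ) e') (sub₂-cong B (λ x → e x ∘ ⊗ʳ) e')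
sub₂-cong (A ⊸ B) e e' =
  cong₂ _⊸_ (sub₂-cong A (λ x → e x ∘ ⊸ˡ) e') (sub₂-cong B (λ x → e x ∘ ⊸ʳ) e')
sub₂-cong (ex A) e e' =
  cong ex (sub₂-cong A (λ x → cong weakenT ∘ e x ∘ exF) (liftS-cong e'))
sub₂-cong (all A) e e' =
  cong all (sub₂-cong A (λ x → cong weakenT ∘ e x ∘ allF) (liftS-cong e'))

sub₂T-weaken : ∀ {k j} (f : ℕ → Term j) (s : Fin k → Term j) t →
               sub₂T (weakenT ∘ f) (liftS s) (weakenT t) ≡ weakenT (sub₂T f s t)
sub₂T-weaken f s (free x)  = refl
sub₂T-weaken f s (bound i) = refl

liftS-∘ : ∀ {k j l} (f : ℕ → Term l) (s : Fin j → Term l) (s' : Fin k → Term j) →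
          sub₂T (weakenT ∘ f) (liftS s) ∘ liftS s' ≗ liftS (sub₂T f s ∘ s')
liftS-∘ f s s' zero    = refl
liftS-∘ f s s' (suc i) = sub₂T-weaken f s (s' i)

sub₂-∘ : ∀ {k j l} (f : ℕ → Term l) (s : Fin j → Term l) (f' : ℕ → Term j) (s' : Fin k → Term j) A →
         sub₂ f s (sub₂ f' s' A) ≡ sub₂ (sub₂T f s ∘ f') (sub₂T f s ∘ s') A
sub₂-∘ f s f' s' (atom p xs) = cong (atom p) (trans (sym (map-∘ xs)) (sub₂Ts-eq xs))
  where
  sub₂Ts-eq : ∀ xs → map (sub₂T f s ∘ sub₂T f' s') xs ≡ map (sub₂T (sub₂T f s ∘ f') (sub₂T f s ∘ s')) xs
  sub₂Ts-eq [] = refl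
  sub₂Ts-eq (free x ∷ xs)  = cong (_ ∷_) (sub₂Ts-eq xs)
  sub₂Ts-eq (bound i ∷ xs) = cong (_ ∷_) (sub₂Ts-eq xs)
sub₂-∘ f s f' s' (A ⊗ B) = cong₂ _⊗_ (sub₂-∘ f s f' s' A) (sub₂-∘ f s f' s' B)
sub₂-∘ f s f' s' (A ⊸ B) = cong₂ _⊸_ (sub₂-∘ f s f' s' A) (sub₂-∘ f s f' s' B)
sub₂-∘ f s f' s' (ex A) = cong ex (trans (sub₂-∘ _ _ _ _ A)
  (sub₂-cong A (λ x _ → sub₂T-weaken f s (f' x)) (liftS-∘ f s s')))
sub₂-∘ f s f' s' (all A) = cong all (trans (sub₂-∘ _ _ _ _ A)
  (sub₂-cong A (λ x _ → sub₂T-weaken f s (f' x)) (liftS-∘ f s s')))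

renT-sub₂T : ∀ {k} h (t : Term k) → renT h t ≡ sub₂T (free ∘ h) bound t
renT-sub₂T h (free x)  = refl
renT-sub₂T h (bound i) = refl

subT-sub₂T : ∀ {k j} (s : Fin k → Term j) (t : Term k) → subT s t ≡ sub₂T free s t
subT-sub₂T s (free x)  = refl
subT-sub₂T s (bound i) = refl

liftS-bound : ∀ {k} → liftS {k} bound ≗ bound
liftS-bound zero    = refl
liftS-bound (suc i) = refl

ren-sub₂ : ∀ {k} h (A : Formula k) → ren h A ≡ sub₂ (free ∘ h) bound A
ren-sub₂ h (atom p xs) = cong (atom p) (map-cong (renT-sub₂T h) xs)
ren-sub₂ h (A ⊗ B) = cong₂ _⊗_ (ren-sub₂ h A) (ren-sub₂ h B)
ren-sub₂ h (A ⊸ B) = cong₂ _⊸_ (ren-sub₂ h A) (ren-sub₂ h B)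
ren-sub₂ h (ex A) = cong ex (trans (ren-sub₂ h A) (sub₂-cong A (λ _ _ → refl) (sym ∘ liftS-bound)))
ren-sub₂ h (all A) = cong all (trans (ren-sub₂ h A) (sub₂-cong A (λ _ _ → refl) (sym ∘ liftS-bound)))

subF-sub₂ : ∀ {k j} (s : Fin k → Term j) (A : Formula k) → subF s A ≡ sub₂ free s A
subF-sub₂ s (atom p xs) = cong (atom p) (map-cong (subT-sub₂T s) xs)
subF-sub₂ s (A ⊗ B) = cong₂ _⊗_ (subF-sub₂ s A) (subF-sub₂ s B)
subF-sub₂ s (A ⊸ B) = cong₂ _⊸_ (subF-sub₂ s A) (subF-sub₂ s B)
subF-sub₂ s (ex A) = cong ex (subF-sub₂ _ A)
subF-sub₂ s (all A) = cong all (subF-sub₂ _ A)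

renT-id : ∀ {k} (t : Term k) → renT id t ≡ t
renT-id (free x)  = refl
renT-id (bound i) = refl

ren-id : ∀ {k} (A : Formula k) → ren id A ≡ A
ren-id (atom p xs) = cong (atom p) (trans (map-cong renT-id xs) (map-id xs))
ren-id (A ⊗ B) = cong₂ _⊗_ (ren-id A) (ren-id B)
ren-id (A ⊸ B) = cong₂ _⊸_ (ren-id A) (ren-id B)
ren-id (ex A) = cong ex (ren-id A)
ren-id (all A) = cong all (ren-id A)

sub₂-id : (A : Formula 0) {s : Fin 0 → Term 0} → sub₂ free s A ≡ A
sub₂-id A = trans (sub₂-cong A (λ _ _ → refl) (λ ())) (trans (sym (ren-sub₂ id A)) (ren-id A))

ren-cong : ∀ {k} {h h' : ℕ → ℕ} (A : Formula k) → (∀ x → FreeIn x A → h x ≡ h' x) → ren h A ≡ ren h' A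
ren-cong {h = h} {h'} A e = trans (ren-sub₂ h A)
  (trans (sub₂-cong A (λ x → cong free ∘ e x) (λ _ → refl)) (sym (ren-sub₂ h' A)))

infixr 5 _▹_
_▹_ : ∀ {ℓ} {X : Set ℓ} {k} → X → (Fin k → X) → Fin (suc k) → X
(y ▹ ε) zero    = y
(y ▹ ε) (suc i) = ε i

-- The closed formula A[β, ε]: free names through β, bound variables to the names ε.
⟦_⟧ : ∀ {k} → Formula k → (ℕ → ℕ) → (Fin k → ℕ) → Formula 0
⟦ A ⟧ β ε = sub₂ (free ∘ β) (free ∘ ε) A

inst-⟦⟧ : ∀ {k} (A : Formula (suc k)) β ε y →
          inst (sub₂ (weakenT ∘ free ∘ β) (liftS (free ∘ ε)) A) y ≡ ⟦ A ⟧ β (y ▹ ε)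
inst-⟦⟧ A β ε y = trans (subF-sub₂ (openS y) _) (trans (sub₂-∘ _ _ _ _ A)
  (sub₂-cong A (λ _ _ → refl) λ { zero → refl ; (suc i) → refl }))

ren-inst : (A : Formula 1) → ∀ h y → ren h (inst A y) ≡ inst (ren h A) (h y)
ren-inst A h y = begin
  ren h (inst A y)                                ≡⟨ ren-sub₂ h _ ⟩
  sub₂ (free ∘ h) bound (inst A y)                ≡⟨ cong (sub₂ _ _) (subF-sub₂ _ A) ⟩
  sub₂ (free ∘ h) bound (sub₂ free (openS y) A)   ≡⟨ sub₂-∘ _ _ _ _ A ⟩
  _                                               ≡⟨ sub₂-cong A (λ _ _ → refl) (λ { zero → refl }) ⟩
  _                                               ≡⟨ sub₂-∘ _ _ _ _ A ⟨
  sub₂ free (openS (h y)) (sub₂ (free ∘ h) bound A) ≡⟨ cong (sub₂ _ _) (ren-sub₂ h A) ⟨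
  sub₂ free (openS (h y)) (ren h A)               ≡⟨ subF-sub₂ _ _ ⟨
  inst (ren h A) (h y)                            ∎
  where open ≡-Reasoning

-- Bounds on free names, and abstraction of names

boundTs : ∀ {k} → List (Term k) → ℕ
boundTs []             = 0
boundTs (free x ∷ xs)  = suc x ⊔ boundTs xs
boundTs (bound _ ∷ xs) = boundTs xs

-- The bound is strict, so it is itself a fresh name; eigenvariables and fresh selectors are
-- obtained this way.
boundF : ∀ {k} → Formula k → ℕ
boundF (atom p xs) = boundTs xs
boundF (A ⊗ B) = boundF A ⊔ boundF B
boundF (A ⊸ B) = boundF A ⊔ boundF B
boundF (ex A)  = boundF A
boundF (all A) = boundF A

boundCtx : List (Formula 0) → ℕ
boundCtx []      = 0
boundCtx (A ∷ Γ) = boundF A ⊔ boundCtx Γ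

freeTs<bound : ∀ {k x} (xs : List (Term k)) → Any (_≡_ (free x)) xs → x < boundTs xs
freeTs<bound (free x ∷ xs)  (here refl) = m≤m⊔n (suc x) (boundTs xs)
freeTs<bound (free x ∷ xs)  (there a)   = ≤-trans (freeTs<bound xs a) (m≤n⊔m (suc x) _)
freeTs<bound (bound i ∷ xs) (there a)   = freeTs<bound xs a

free<bound : ∀ {k x} {A : Formula k} → FreeIn x A → x < boundF A
free<bound (atomF a)      = freeTs<bound _ a
free<bound (⊗ˡ a)         = ≤-trans (free<bound a) (m≤m⊔n _ _)
free<bound (⊗ʳ {A = A} a) = ≤-trans (free<bound a) (m≤n⊔m (boundF A) _)
free<bound (⊸ˡ a)         = ≤-trans (free<bound a) (m≤m⊔n _ _)
free<bound (⊸ʳ {A = A} a) = ≤-trans (free<bound a) (m≤n⊔m (boundF A) _)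
free<bound (exF a)        = free<bound a
free<bound (allF a)       = free<bound a

freeCtx<bound : ∀ {x} Γ → FreeInCtx x Γ → x < boundCtx Γ
freeCtx<bound (A ∷ Γ) (here a)  = ≤-trans (free<bound a) (m≤m⊔n _ _)
freeCtx<bound (A ∷ Γ) (there a) = ≤-trans (freeCtx<bound Γ a) (m≤n⊔m (boundF A) _)

toBound : (b x : ℕ) → Term b
toBound b x with x <? b
... | yes x<b = bound (fromℕ< x<b)
-- A default value: every name of `A` lies below `boundF A`.
... | no _    = free x

-- A as an instance of a formula without free names: its names are abstracted into bound variables.
abstractF : (A : Formula 0) → Formula (boundF A)
abstractF A = sub₂ (toBound (boundF A)) (λ ()) A

subF-abstractF : ∀ A β → subF (free ∘ β ∘ toℕ) (abstractF A) ≡ ⟦ A ⟧ β (λ ())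
subF-abstractF A β = trans (subF-sub₂ _ _) (trans (sub₂-∘ _ _ _ _ A) (sub₂-cong A lem (λ ())))
  where
  lem : ∀ x → FreeIn x A → sub₂T free (free ∘ β ∘ toℕ) (toBound (boundF A) x) ≡ free (β x)
  lem x a with x <? boundF A
  ... | yes x<b = cong (free ∘ β) (toℕ-fromℕ< x<b)
  ... | no x≮b  = ⊥-elim (x≮b (free<bound a))

-- Parallel composition

just≢nothing : ∀ {X : Set} {x : X} {m : Maybe X} → m ≡ just x → m ≡ nothing → ⊥
just≢nothing refl ()

-- Decidable subsets and quotients of finite sets

record Listing {N : ℕ} (P : Fin N → Set) : Set where
  field
    size    : ℕ
    emb     : Fin size → Fin N
    emb-inj : ∀ {i j} → emb i ≡ emb j → i ≡ j
    emb-P   : ∀ i → P (emb i)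
    index   : ∀ v → P v → ∃ λ i → emb i ≡ v

listing : ∀ {N} {P : Fin N → Set} → (∀ v → Dec (P v)) → Listing P
listing {zero} P? = record
  { size = 0 ; emb = λ () ; emb-inj = λ { {()} } ; emb-P = λ () ; index = λ () }
listing {suc N} {P} P? with P? zero | listing (P? ∘ suc)
... | yes p | L = record
  { size = suc size
  ; emb = emb'
  ; emb-inj = inj'
  ; emb-P = λ { zero → p ; (suc i) → emb-P i }
  ; index = λ { zero _ → zero , refl
              ; (suc v) q → suc (proj₁ (index v q)) , cong suc (proj₂ (index v q)) } }
  where
  open Listing L
  emb' : Fin (suc size) → Fin (suc N)
  emb' zero    = zero
  emb' (suc i) = suc (emb i)
  inj' : ∀ {i j} → emb' i ≡ emb' j → i ≡ j
  inj' {zero}  {zero}  e = refl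
  inj' {suc i} {suc j} e = cong suc (emb-inj (suc-injective e))
... | no ¬p | L = record
  { size = size
  ; emb = suc ∘ emb
  ; emb-inj = emb-inj ∘ suc-injective
  ; emb-P = emb-P
  ; index = λ { zero q → ⊥-elim (¬p q)
              ; (suc v) q → proj₁ (index v q) , cong suc (proj₂ (index v q)) } }
  where open Listing L

record Reps {X : Set} (_~_ : X → X → Set) (pairs : ℕ → Maybe (X × X)) (b : ℕ) : Set where
  field
    rep      : X → X
    rep-idem : ∀ x → rep (rep x) ≡ rep x
    rep~     : ∀ x → rep x ~ x
    rep-pair : ∀ σ → σ < b → ∀ x y → pairs σ ≡ just (x , y) → rep x ≡ rep y

-- Union-find on the pairs below `b`: a new pair `(p , q)` redirects the class of `q` to the
-- representative of `p`. Only related elements are ever merged, since each pair lies in the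
-- equivalence.
reps : ∀ {X : Set} {_~_ : X → X → Set} → DecidableEquality X → IsEquivalence _~_ →
       (pairs : ℕ → Maybe (X × X)) → (∀ σ x y → pairs σ ≡ just (x , y) → x ~ y) → ∀ b → Reps _~_ pairs b
reps _≟X_ eq pairs sound zero = record
  { rep = id ; rep-idem = λ _ → refl ; rep~ = λ _ → refl~ ; rep-pair = λ _ () }
  where open IsEquivalence eq renaming (refl to refl~)
reps {X} {_~_} _≟X_ eq pairs sound (suc b) with reps _≟X_ eq pairs sound b | pairs b in pb
... | R | nothing = record
  { rep = rep ; rep-idem = rep-idem ; rep~ = rep~ ; rep-pair = pair' }
  where
  open Reps R
  pair' : ∀ σ → σ < suc b → ∀ x y → pairs σ ≡ just (x , y) → rep x ≡ rep y
  pair' σ σ<sb x y e with m≤n⇒m<n∨m≡n (≤-pred σ<sb)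
  ... | inj₁ σ<b  = rep-pair σ σ<b x y e
  ... | inj₂ refl = ⊥-elim (just≢nothing e pb)
... | R | just (p , q) = record
  { rep = rep' ; rep-idem = idem' ; rep~ = rep'~ ; rep-pair = pair' }
  where
  open Reps R
  open IsEquivalence eq renaming (refl to refl~; sym to sym~; trans to trans~)
  rep' : X → X
  rep' x with rep x ≟X rep q
  ... | yes _ = rep p
  ... | no _  = rep x
  rep'-q : ∀ x → rep x ≡ rep q → rep' x ≡ rep p
  rep'-q x e with rep x ≟X rep q
  ... | yes _ = refl
  ... | no ¬e = ⊥-elim (¬e e)
  rep'-cong : ∀ {x y} → rep x ≡ rep y → rep' x ≡ rep' y
  rep'-cong {x} {y} e with rep x ≟X rep q | rep y ≟X rep q
  ... | yes _ | yes _ = refl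
  ... | yes d | no ¬d = ⊥-elim (¬d (trans (sym e) d))
  ... | no ¬d | yes d = ⊥-elim (¬d (trans e d))
  ... | no _  | no _  = e
  rep'-p : rep' p ≡ rep p
  rep'-p with rep p ≟X rep q
  ... | yes _ = refl
  ... | no _  = refl
  idem' : ∀ x → rep' (rep' x) ≡ rep' x
  idem' x with rep x ≟X rep q
  ... | yes _ = trans (rep'-cong (rep-idem p)) rep'-p
  ... | no ¬e with rep (rep x) ≟X rep q
  ...   | yes e = ⊥-elim (¬e (trans (sym (rep-idem x)) e))
  ...   | no _  = rep-idem x
  rep'~ : ∀ x → rep' x ~ x
  rep'~ x with rep x ≟X rep q
  ... | yes e = trans~ (rep~ p) (trans~ (sound b p q pb)
                  (trans~ (sym~ (rep~ q)) (subst (_~ x) e (rep~ x))))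
  ... | no _  = rep~ x
  pair' : ∀ σ → σ < suc b → ∀ x y → pairs σ ≡ just (x , y) → rep' x ≡ rep' y
  pair' σ σ<sb x y e with m≤n⇒m<n∨m≡n (≤-pred σ<sb)
  ... | inj₁ σ<b  = rep'-cong (rep-pair σ σ<b x y e)
  ... | inj₂ refl with refl ← just-injective (trans (sym pb) e) = trans rep'-p (sym (rep'-q q refl))

record Quotient {X : Set} (_~_ : X → X → Set) : Set where
  field
    size   : ℕ
    q      : X → Fin size
    q-surj : ∀ i → ∃ λ x → q x ≡ i
    q-ker  : ∀ x y → (q x ≡ q y) ⇔ (x ~ y)

-- The classes are the fixed points of `rep`. Elements with equal `q` are related because each is
-- related to its representative; conversely, every generator is one of the pairs below `b`, which
-- `reps` has merged.
quotient : ∀ {X : Set} {n} (R : X → X → Set) → X ↔ Fin n → (pairs : ℕ → Maybe (X × X)) (b : ℕ) →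
           (∀ σ x y → pairs σ ≡ just (x , y) → EqClosure R x y) →
           (∀ x y → R x y → ∃ λ σ → σ < b × pairs σ ≡ just (x , y)) →
           Quotient (EqClosure R)
quotient {X} {n} R X↔ pairs b sound complete = record
  { size = size ; q = q ; q-surj = surj ; q-ker = λ x y → mk⇔ (to x y) (from {x} {y}) }
  where
  open Inverse X↔ using () renaming (to to enc; from to dec; strictlyInverseʳ to dec-enc; strictlyInverseˡ to enc-dec)
  _≟X_ : DecidableEquality X
  x ≟X y with enc x ≟ enc y
  ... | yes e = yes (trans (sym (dec-enc x)) (trans (cong dec e) (dec-enc y)))
  ... | no ¬e = no (¬e ∘ cong enc)
  equivalence = EC.isEquivalence R
  open IsEquivalence equivalence renaming (refl to refl~; sym to sym~; trans to trans~)
  open Reps (reps _≟X_ equivalence pairs sound b)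
  Canonical : Fin n → Set
  Canonical v = rep (dec v) ≡ dec v
  open Listing (listing {P = Canonical} (λ v → rep (dec v) ≟X dec v))
  canonical : ∀ x → Canonical (enc (rep x))
  canonical x rewrite dec-enc (rep x) = rep-idem x
  q : X → Fin size
  q x = proj₁ (index _ (canonical x))
  emb-q : ∀ x → emb (q x) ≡ enc (rep x)
  emb-q x = proj₂ (index _ (canonical x))
  surj : ∀ i → ∃ λ x → q x ≡ i
  surj i = dec (emb i) , emb-inj (trans (emb-q _) (trans (cong enc (emb-P i)) (enc-dec _)))
  to : ∀ x y → q x ≡ q y → EqClosure R x y
  to x y e = trans~ (sym~ (rep~ x)) (subst (λ z → EqClosure R z y) (sym rep≡) (rep~ y))
    where
    rep≡ : rep x ≡ rep y
    rep≡ = trans (sym (dec-enc _)) (trans (cong dec (trans (sym (emb-q x)) (trans (cong emb e) (emb-q y)))) (dec-enc _))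
  from : ∀ {x y} → EqClosure R x y → q x ≡ q y
  from = EC.gfold isEquivalence q λ {x} {y} r → let σ , σ<b , e = complete x y r in
    emb-inj (trans (emb-q x) (trans (cong enc (rep-pair σ σ<b x y e)) (sym (emb-q y))))

ext<fin : ∀ {T} (H : Hypergraph T) {σ v} → ext H σ ≡ just v → σ < proj₁ (ext-fin H)
ext<fin H {σ} {v} e with σ <? proj₁ (ext-fin H)
... | yes σ<b = σ<b
... | no σ≮b with trans (cong is-just (sym e)) (proj₂ (ext-fin H) σ (≮⇒≥ σ≮b))
... | ()

map-just⁻ : ∀ {X Y : Set} {f : X → Y} (m : Maybe X) {y} → Maybe.map f m ≡ just y → ∃ λ x → m ≡ just x × f x ≡ y
map-just⁻ (just x) refl = x , refl , refl

-- Existence, symmetry and unit of parallel composition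

module _ {T : Alphabet} where

  par-construct : (H₁ H₂ : Hypergraph T) → ∃ λ H → Par H₁ H₂ H
  par-construct H₁ H₂ = H , record
    { g = q ; g-surj = q-surj ; g-ker = q-ker ; k = ↔-sym +↔⊎
    ; lab₁ = λ e → cong [ lab H₁ , lab H₂ ] (splitAt-join _ _ (inj₁ e))
    ; lab₂ = λ e → cong [ lab H₁ , lab H₂ ] (splitAt-join _ _ (inj₂ e))
    ; att₁ = λ e σ → cong (λ c → att' c σ) (splitAt-join _ _ (inj₁ e))
    ; att₂ = λ e σ → cong (λ c → att' c σ) (splitAt-join _ _ (inj₂ e))
    ; ext₁ = ext₁' ; ext₂ = ext₂' ; extN = extN' }
    where
    b : ℕ
    -- A gluing selector is external in both factors, so the bound of `H₁` already covers all gluing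
    -- pairs.
    b = proj₁ (ext-fin H₁)
    pair : Maybe (Fin (nV H₁)) → Maybe (Fin (nV H₂)) → Maybe ((Fin (nV H₁) ⊎ Fin (nV H₂)) × (Fin (nV H₁) ⊎ Fin (nV H₂)))
    pair (just a) (just c) = just (inj₁ a , inj₂ c)
    pair _        _        = nothing
    sound : ∀ σ x y → pair (ext H₁ σ) (ext H₂ σ) ≡ just (x , y) → EqClosure (ParGlue H₁ H₂) x y
    sound σ x y e with ext H₁ σ in e₁ | ext H₂ σ in e₂
    sound σ _ _ refl | just a | just c = EC.return (glue σ a c e₁ e₂)
    complete : ∀ x y → ParGlue H₁ H₂ x y → ∃ λ σ → σ < b × pair (ext H₁ σ) (ext H₂ σ) ≡ just (x , y)
    complete _ _ (glue σ a c e₁ e₂) = σ , ext<fin H₁ e₁ , cong₂ pair e₁ e₂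
    Q : Quotient (EqClosure (ParGlue H₁ H₂))
    Q = quotient (ParGlue H₁ H₂) (↔-sym +↔⊎) (λ σ → pair (ext H₁ σ) (ext H₂ σ)) b sound complete
    open Quotient Q
    att' : Fin (nE H₁) ⊎ Fin (nE H₂) → ℕ → Maybe (Fin size)
    att' (inj₁ e) σ = Maybe.map (q ∘ inj₁) (att H₁ e σ)
    att' (inj₂ e) σ = Maybe.map (q ∘ inj₂) (att H₂ e σ)
    is-just-map : ∀ {X Y : Set} (f : X → Y) m → is-just (Maybe.map f m) ≡ is-just m
    is-just-map f (just _) = refl
    is-just-map f nothing  = refl
    att-dom' : ∀ e σ → is-just (att' e σ) ≡ type T ([ lab H₁ , lab H₂ ] e) σ
    att-dom' (inj₁ e) σ = trans (is-just-map _ (att H₁ e σ)) (att-dom H₁ e σ)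
    att-dom' (inj₂ e) σ = trans (is-just-map _ (att H₂ e σ)) (att-dom H₂ e σ)
    ext' : Maybe (Fin (nV H₁)) → Maybe (Fin (nV H₂)) → Maybe (Fin size)
    ext' (just a) _        = just (q (inj₁ a))
    ext' nothing  (just c) = just (q (inj₂ c))
    ext' nothing  nothing  = nothing
    fin' : FiniteSet (λ σ → is-just (ext' (ext H₁ σ) (ext H₂ σ)))
    fin' = b ⊔ proj₁ (ext-fin H₂) , lem
      where
      lem : ∀ σ → b ⊔ proj₁ (ext-fin H₂) ≤ σ → is-just (ext' (ext H₁ σ) (ext H₂ σ)) ≡ false
      lem σ le with ext H₁ σ in e₁ | ext H₂ σ in e₂
      ... | just _  | _       = ⊥-elim (<⇒≱ (ext<fin H₁ e₁) (≤-trans (m≤m⊔n _ _) le))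
      ... | nothing | just _  = ⊥-elim (<⇒≱ (ext<fin H₂ e₂) (≤-trans (m≤n⊔m b _) le))
      ... | nothing | nothing = refl
    H : Hypergraph T
    H = record
      { nV = size ; nE = nE H₁ + nE H₂
      ; lab = [ lab H₁ , lab H₂ ] ∘ splitAt (nE H₁) ; att = att' ∘ splitAt (nE H₁)
      ; att-dom = att-dom' ∘ splitAt (nE H₁)
      ; ext = λ σ → ext' (ext H₁ σ) (ext H₂ σ) ; ext-fin = fin' }
    ext₁' : ∀ σ v → ext H₁ σ ≡ just v → ext H σ ≡ just (q (inj₁ v))
    ext₁' σ v e rewrite e = refl
    ext₂' : ∀ σ v → ext H₂ σ ≡ just v → ext H σ ≡ just (q (inj₂ v))
    ext₂' σ v e₂ with ext H₁ σ in e₁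
    -- `ext'` prefers the left node; gluing along `σ` identifies it with the right one.
    ... | just a = cong just (Equivalence.from (q-ker _ _) (EC.return (glue σ a v e₁ e₂)))
    ... | nothing rewrite e₂ = refl
    extN' : ∀ σ → ext H₁ σ ≡ nothing → ext H₂ σ ≡ nothing → ext H σ ≡ nothing
    extN' σ e₁ e₂ rewrite e₁ | e₂ = refl

  abstract
    -- Associativity and the ⊸ clause need some composite as a witness. It is sealed because nothing
    -- depends on which quotient represents it.
    par-exists : (H₁ H₂ : Hypergraph T) → ∃ λ H → Par H₁ H₂ H
    par-exists = par-construct

  swap-glue : ∀ {H₁ H₂ : Hypergraph T} {x y} → ParGlue H₁ H₂ x y → EqClosure (ParGlue H₂ H₁) (swap x) (swap y)
  swap-glue {H₁} {H₂} (glue σ a b e₁ e₂) = EC.symmetric (ParGlue H₂ H₁) (EC.return (glue σ b a e₂ e₁))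

  par-comm : ∀ {H₁ H₂ H : Hypergraph T} → Par H₁ H₂ H → Par H₂ H₁ H
  par-comm {H₁} {H₂} P = record
    { g = g ∘ swap
    ; g-surj = λ v → swap (proj₁ (g-surj v)) , trans (cong g (Sum.swap-involutive _)) (proj₂ (g-surj v))
    ; g-ker = λ x y → mk⇔
        (λ e → subst₂ (EqClosure (ParGlue H₂ H₁)) (Sum.swap-involutive x) (Sum.swap-involutive y)
                 (swap~ (Equivalence.to (g-ker (swap x) (swap y)) e)))
        (λ r → Equivalence.from (g-ker (swap x) (swap y)) (swap~ r))
    ; k = k ↔-∘ ⊎-comm _ _
    ; lab₁ = lab₂ ; lab₂ = lab₁ ; att₁ = att₂ ; att₂ = att₁
    ; ext₁ = ext₂ ; ext₂ = ext₁ ; extN = λ σ e₁ e₂ → extN σ e₂ e₁ }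
    where
    open Par P
    swap~ : ∀ {H₁ H₂ : Hypergraph T} {x y} → EqClosure (ParGlue H₁ H₂) x y → EqClosure (ParGlue H₂ H₁) (swap x) (swap y)
    swap~ {H₁} {H₂} = EC.gfold (EC.isEquivalence (ParGlue H₂ H₁)) swap swap-glue

  map-map : ∀ {X Y Z : Set} {f : Y → Z} {g : X → Y} (m : Maybe X) → Maybe.map f (Maybe.map g m) ≡ Maybe.map (f ∘ g) m
  map-map (just _) = refl
  map-map nothing  = refl

  map-≗ : ∀ {X Y : Set} {f g : X → Y} → f ≗ g → (m : Maybe X) → Maybe.map f m ≡ Maybe.map g m
  map-≗ e (just x) = cong just (e x)
  map-≗ e nothing  = refl

  K₀ : Hypergraph T
  K₀ = record { nV = 0 ; nE = 0 ; lab = λ () ; att = λ () ; att-dom = λ ()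
              ; ext = λ _ → nothing ; ext-fin = 0 , λ _ _ → refl }

  K₀-empty : IsEmpty K₀
  K₀-empty = refl , refl , λ _ → refl

  ⊎-empty↔ : ∀ {X : Set} {n} → n ≡ 0 → X ↔ (X ⊎ Fin n)
  ⊎-empty↔ refl = mk↔ₛ′ inj₁ [ id , (λ ()) ] (λ { (inj₁ _) → refl ; (inj₂ ()) }) (λ _ → refl)

  par-K₀ : (H : Hypergraph T) → Par H K₀ H
  par-K₀ H = record
    { g = [ id , (λ ()) ] ; g-surj = λ v → inj₁ v , refl
    ; g-ker = λ { (inj₁ x) (inj₁ y) → mk⇔ (λ { refl → EC.reflexive _ }) (EC.gfold isEquivalence [ id , (λ ()) ] λ { (glue _ _ () _ _) })
             ; (inj₁ _) (inj₂ ()) ; (inj₂ ()) _ }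
    ; k = ↔-sym (⊎-empty↔ refl)
    ; lab₁ = λ _ → refl ; lab₂ = λ ()
    ; att₁ = λ e σ → sym (map-id' (att H e σ)) ; att₂ = λ ()
    ; ext₁ = λ σ v e → e ; ext₂ = λ _ _ () ; extN = λ σ e _ → e }
    where
    map-id' : ∀ {X : Set} (m : Maybe X) → Maybe.map id m ≡ m
    map-id' (just _) = refl
    map-id' nothing  = refl

  -- Gluing needs a node on each side, so an empty factor causes no identifications and `g` is a
  -- bijection on the other factor.
  par-empty : ∀ {H E K : Hypergraph T} → IsEmpty E → Par H E K → Iso H K
  par-empty {H} {E} {K} (nV0 , nE0 , ext0) P = record
    { fV = mk↔ₛ′ (g ∘ inj₁) (proj₁ ∘ pre) (proj₂ ∘ pre)
             (λ v → inj (proj₂ (pre (g (inj₁ v)))))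
    ; fE = k ↔-∘ ⊎-empty↔ nE0
    ; lab-pres = λ e → trans (cong (lab K ∘ Inverse.to k) (to-inj nE0 e)) (lab₁ e)
    ; att-pres = λ e σ → trans (cong (λ c → att K (Inverse.to k c) σ) (to-inj nE0 e)) (att₁ e σ)
    ; ext-pres = ext' }
    where
    open Par P
    no-V : Fin (nV E) → ⊥
    no-V v with () ← subst Fin nV0 v
    to-inj : ∀ {X : Set} {n} (e : n ≡ 0) (x : X) → Inverse.to (⊎-empty↔ e) x ≡ inj₁ x
    to-inj refl x = refl
    pre : ∀ v → ∃ λ x → g (inj₁ x) ≡ v
    pre v with g-surj v
    ... | inj₁ x , e = x , e
    ... | inj₂ x , e = ⊥-elim (no-V x)
    left : Fin (nV H) ⊎ Fin (nV E) → Fin (nV H)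
    left (inj₁ x) = x
    left (inj₂ x) = ⊥-elim (no-V x)
    inj : ∀ {x y} → g (inj₁ x) ≡ g (inj₁ y) → x ≡ y
    inj e = EC.gfold isEquivalence left (λ { (glue _ _ b _ _) → ⊥-elim (no-V b) }) (Equivalence.to (g-ker _ _) e)
    ext' : ∀ σ → ext K σ ≡ Maybe.map (g ∘ inj₁) (ext H σ)
    ext' σ with ext H σ in e
    ... | just v  = ext₁ σ v e
    ... | nothing = extN σ e (ext0 σ)

  -- Associativity of parallel composition

  module _ {H₁ H₂ H₃ H₁₂ H₂₃ H : Hypergraph T} (P₁₂ : Par H₁ H₂ H₁₂) (P : Par H₁₂ H₃ H) (P₂₃ : Par H₂ H₃ H₂₃) where
    private
      module A = Par P₁₂
      module B = Par P
      module C = Par P₂₃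

    ∼-refl : ∀ {x} → EqClosure (ParGlue H₁ H₂₃) x x
    ∼-refl = EC.reflexive _
    ∼-trans = EC.transitive (ParGlue H₁ H₂₃)
    ∼-sym = EC.symmetric (ParGlue H₁ H₂₃)

    fromLeft : Fin (nV H₁) ⊎ Fin (nV H₂) → Fin (nV H₁) ⊎ Fin (nV H₂₃)
    fromLeft (inj₁ a) = inj₁ a
    fromLeft (inj₂ b) = inj₂ (C.g (inj₁ b))

    fromLeft-cong : ∀ {x y} → A.g x ≡ A.g y → EqClosure (ParGlue H₁ H₂₃) (fromLeft x) (fromLeft y)
    fromLeft-cong e = EC.gfold (EC.isEquivalence (ParGlue H₁ H₂₃)) fromLeft
      (λ { (glue σ a b e₁ e₂) → EC.return (glue σ a _ e₁ (C.ext₁ σ b e₂)) }) (Equivalence.to (A.g-ker _ _) e)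

    -- Inverse to `unassoc` up to gluing. It goes through a chosen preimage under `A.g`, whose
    -- choice is immaterial by `fromLeft-cong`.
    reassoc : Fin (nV H₁₂) ⊎ Fin (nV H₃) → Fin (nV H₁) ⊎ Fin (nV H₂₃)
    reassoc (inj₁ v) = fromLeft (proj₁ (A.g-surj v))
    reassoc (inj₂ c) = inj₂ (C.g (inj₂ c))

    reassoc-g : ∀ x → EqClosure (ParGlue H₁ H₂₃) (reassoc (inj₁ (A.g x))) (fromLeft x)
    reassoc-g x = fromLeft-cong (proj₂ (A.g-surj (A.g x)))

    reassoc-cong : ∀ {x y} → B.g x ≡ B.g y → EqClosure (ParGlue H₁ H₂₃) (reassoc x) (reassoc y)
    reassoc-cong e = EC.gfold (EC.isEquivalence (ParGlue H₁ H₂₃)) reassoc step (Equivalence.to (B.g-ker _ _) e)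
      where
      step : ∀ {x y} → ParGlue H₁₂ H₃ x y → EqClosure (ParGlue H₁ H₂₃) (reassoc x) (reassoc y)
      -- The selector of `H₁₂` comes from `H₁` and gives a gluing pair with `H₂₃`, or it comes only
      -- from `H₂`, and then the two nodes already coincide in `H₂₃`.
      step (glue σ v c e₁₂ e₃) with ext H₁ σ in e₁ | ext H₂ σ in e₂
      ... | just a | _ with refl ← just-injective (trans (sym e₁₂) (A.ext₁ σ a e₁)) =
        ∼-trans (reassoc-g (inj₁ a)) (EC.return (glue σ a _ e₁ (C.ext₂ σ c e₃)))
      ... | nothing | just b with refl ← just-injective (trans (sym e₁₂) (A.ext₂ σ b e₂)) =
        ∼-trans (reassoc-g (inj₂ b))
          (subst (λ w → EqClosure (ParGlue H₁ H₂₃) (inj₂ (C.g (inj₁ b))) (inj₂ w))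
            (just-injective (trans (sym (C.ext₁ σ b e₂)) (C.ext₂ σ c e₃))) ∼-refl)
      ... | nothing | nothing = ⊥-elim (just≢nothing e₁₂ (A.extN σ e₁ e₂))

    unassoc₂₃ : Fin (nV H₂) ⊎ Fin (nV H₃) → Fin (nV H₁₂) ⊎ Fin (nV H₃)
    unassoc₂₃ (inj₁ b) = inj₁ (A.g (inj₂ b))
    unassoc₂₃ (inj₂ c) = inj₂ c

    unassoc : Fin (nV H₁) ⊎ Fin (nV H₂₃) → Fin (nV H₁₂) ⊎ Fin (nV H₃)
    unassoc (inj₁ a) = inj₁ (A.g (inj₁ a))
    unassoc (inj₂ w) = unassoc₂₃ (proj₁ (C.g-surj w))

    reassoc-unassoc : ∀ z → EqClosure (ParGlue H₁ H₂₃) (reassoc (unassoc z)) z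
    reassoc-unassoc (inj₁ a) = reassoc-g (inj₁ a)
    reassoc-unassoc (inj₂ w) with C.g-surj w
    ... | inj₁ b , refl = reassoc-g (inj₂ b)
    ... | inj₂ c , refl = ∼-refl

    gᵃ : Fin (nV H₁) ⊎ Fin (nV H₂₃) → Fin (nV H)
    gᵃ = B.g ∘ unassoc

    gᵃ₂₃ : ∀ x → gᵃ (inj₂ (C.g x)) ≡ B.g (unassoc₂₃ x)
    gᵃ₂₃ x = EC.gfold isEquivalence (B.g ∘ unassoc₂₃)
      (λ { (glue σ b c e₂ e₃) → just-injective
             (trans (sym (B.ext₁ σ _ (A.ext₂ σ b e₂))) (B.ext₂ σ c e₃)) })
      (Equivalence.to (C.g-ker _ _) (proj₂ (C.g-surj (C.g x))))

    extᵃ₁ : ∀ σ a → ext H₁ σ ≡ just a → ext H σ ≡ just (gᵃ (inj₁ a))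
    extᵃ₁ σ a e = B.ext₁ σ _ (A.ext₁ σ a e)

    extᵃ₂ : ∀ σ w → ext H₂₃ σ ≡ just w → ext H σ ≡ just (gᵃ (inj₂ w))
    extᵃ₂ σ w e with ext H₂ σ in e₂ | ext H₃ σ in e₃
    ... | just b | _ with refl ← just-injective (trans (sym e) (C.ext₁ σ b e₂)) =
      trans (B.ext₁ σ _ (A.ext₂ σ b e₂)) (cong just (sym (gᵃ₂₃ (inj₁ b))))
    ... | nothing | just c with refl ← just-injective (trans (sym e) (C.ext₂ σ c e₃)) =
      trans (B.ext₂ σ c e₃) (cong just (sym (gᵃ₂₃ (inj₂ c))))
    ... | nothing | nothing = ⊥-elim (just≢nothing e (C.extN σ e₂ e₃))

    extᵃN : ∀ σ → ext H₁ σ ≡ nothing → ext H₂₃ σ ≡ nothing → ext H σ ≡ nothing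
    extᵃN σ e₁ e₂₃ with ext H₂ σ in e₂ | ext H₃ σ in e₃
    ... | just b | _ = ⊥-elim (just≢nothing (C.ext₁ σ b e₂) e₂₃)
    ... | nothing | just c = ⊥-elim (just≢nothing (C.ext₂ σ c e₃) e₂₃)
    ... | nothing | nothing = B.extN σ (A.extN σ e₁ e₂) e₃

    gᵃ-surj : ∀ v → ∃ λ x → gᵃ x ≡ v
    gᵃ-surj v with B.g-surj v
    ... | inj₂ c , refl = inj₂ (C.g (inj₂ c)) , gᵃ₂₃ (inj₂ c)
    ... | inj₁ w , refl with A.g-surj w
    ...   | inj₁ a , refl = inj₁ a , refl
    ...   | inj₂ b , refl = inj₂ (C.g (inj₁ b)) , gᵃ₂₃ (inj₁ b)

    kᵃ : (Fin (nE H₁) ⊎ Fin (nE H₂₃)) ↔ Fin (nE H)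
    kᵃ = B.k ↔-∘ ((A.k ⊎-↔ ↔-id _) ↔-∘ (↔-sym (⊎-assoc 0ℓ _ _ _) ↔-∘ (↔-id _ ⊎-↔ ↔-sym C.k)))

    side : Fin (nE H₂) ⊎ Fin (nE H₃) → Fin (nE H)
    side (inj₁ e) = Inverse.to B.k (inj₁ (Inverse.to A.k (inj₂ e)))
    side (inj₂ e) = Inverse.to B.k (inj₂ e)

    kᵃ-side : ∀ c → Inverse.to kᵃ (inj₂ (Inverse.to C.k c)) ≡ side c
    kᵃ-side c rewrite Inverse.strictlyInverseʳ C.k c with c
    ... | inj₁ e = refl
    ... | inj₂ e = refl

    labᵃ₂ : ∀ e → lab H (Inverse.to kᵃ (inj₂ e)) ≡ lab H₂₃ e
    labᵃ₂ e = subst (λ e → lab H (Inverse.to kᵃ (inj₂ e)) ≡ lab H₂₃ e) (Inverse.strictlyInverseˡ C.k e) (lem (Inverse.from C.k e))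
      where
      lem : ∀ c → lab H (Inverse.to kᵃ (inj₂ (Inverse.to C.k c))) ≡ lab H₂₃ (Inverse.to C.k c)
      lem c = trans (cong (lab H) (kᵃ-side c)) (lem' c)
        where
        lem' : ∀ c → lab H (side c) ≡ lab H₂₃ (Inverse.to C.k c)
        lem' (inj₁ e) = trans (B.lab₁ _) (trans (A.lab₂ e) (sym (C.lab₁ e)))
        lem' (inj₂ e) = trans (B.lab₂ e) (sym (C.lab₂ e))

    attᵃ₂ : ∀ e σ → att H (Inverse.to kᵃ (inj₂ e)) σ ≡ Maybe.map (gᵃ ∘ inj₂) (att H₂₃ e σ)
    attᵃ₂ e σ = subst (λ e → att H (Inverse.to kᵃ (inj₂ e)) σ ≡ Maybe.map (gᵃ ∘ inj₂) (att H₂₃ e σ))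
      (Inverse.strictlyInverseˡ C.k e) (lem (Inverse.from C.k e))
      where
      lem' : ∀ c → att H (side c) σ ≡ Maybe.map (gᵃ ∘ inj₂) (att H₂₃ (Inverse.to C.k c) σ)
      lem' (inj₁ e) = begin
        _ ≡⟨ B.att₁ _ σ ⟩
        _ ≡⟨ cong (Maybe.map (B.g ∘ inj₁)) (A.att₂ e σ) ⟩
        _ ≡⟨ map-map (att H₂ e σ) ⟩
        _ ≡⟨ map-≗ (λ b → gᵃ₂₃ (inj₁ b)) (att H₂ e σ) ⟨
        _ ≡⟨ map-map (att H₂ e σ) ⟨
        _ ≡⟨ cong (Maybe.map (gᵃ ∘ inj₂)) (C.att₁ e σ) ⟨
        _ ∎
        where open ≡-Reasoning
      lem' (inj₂ e) = begin
        _ ≡⟨ B.att₂ _ σ ⟩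
        _ ≡⟨ map-≗ (λ b → gᵃ₂₃ (inj₂ b)) (att H₃ e σ) ⟨
        _ ≡⟨ map-map (att H₃ e σ) ⟨
        _ ≡⟨ cong (Maybe.map (gᵃ ∘ inj₂)) (C.att₂ e σ) ⟨
        _ ∎
        where open ≡-Reasoning
      lem : ∀ c → att H (Inverse.to kᵃ (inj₂ (Inverse.to C.k c))) σ ≡ Maybe.map (gᵃ ∘ inj₂) (att H₂₃ (Inverse.to C.k c) σ)
      lem c = trans (cong (λ e → att H e σ) (kᵃ-side c)) (lem' c)

    -- No comparison of two iterated quotients is made: the kernel of `gᵃ` is computed by passing
    -- along `unassoc`, applying `reassoc-cong` and returning by `reassoc-unassoc`.
    par-assoc : Par H₁ H₂₃ H
    par-assoc = record
      { g = gᵃ ; g-surj = gᵃ-surj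
      ; g-ker = λ x y → mk⇔
          (λ e → ∼-trans (∼-sym (reassoc-unassoc x)) (∼-trans (reassoc-cong e) (reassoc-unassoc y)))
          (EC.gfold isEquivalence gᵃ λ { (glue σ a w e₁ e₂₃) →
             just-injective (trans (sym (extᵃ₁ σ a e₁)) (extᵃ₂ σ w e₂₃)) })
      ; k = kᵃ
      ; lab₁ = λ e → trans (B.lab₁ _) (A.lab₁ e)
      ; lab₂ = labᵃ₂
      ; att₁ = λ e σ → trans (B.att₁ _ σ) (trans (cong (Maybe.map _) (A.att₁ e σ)) (map-map (att H₁ e σ)))
      ; att₂ = attᵃ₂
      ; ext₁ = extᵃ₁ ; ext₂ = extᵃ₂ ; extN = extᵃN }

-- Soundness

module _ {T : Alphabet} (M : Model T) where

  -- Unlike uCtx, this has no special case for singletons.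
  uCtx₀ : List (Formula 0) → Lang {T}
  uCtx₀ []      = IsEmpty
  uCtx₀ (A ∷ Γ) = u M A ∥ uCtx₀ Γ

  uCtx⇒uCtx₀ : ∀ Γ H → uCtx M Γ H → uCtx₀ Γ H
  uCtx⇒uCtx₀ []          H e = e
  uCtx⇒uCtx₀ (A ∷ [])    H a = H , K₀ , a , K₀-empty {T} , par-K₀ H
  uCtx⇒uCtx₀ (A ∷ B ∷ Γ) H (H₁ , H₂ , a , b , P) = H₁ , H₂ , a , uCtx⇒uCtx₀ (B ∷ Γ) H₂ b , P

  uCtx₀⇒uCtx : ∀ Γ H → uCtx₀ Γ H → uCtx M Γ H
  uCtx₀⇒uCtx []          H e = e
  uCtx₀⇒uCtx (A ∷ [])    H (H₁ , E , a , e , P) = iso-closed M A (par-empty e P) a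
  uCtx₀⇒uCtx (A ∷ B ∷ Γ) H (H₁ , H₂ , a , b , P) = H₁ , H₂ , a , uCtx₀⇒uCtx (B ∷ Γ) H₂ b , P

  ∥-assocʳ : ∀ {L₁ L₂ L₃ : Lang {T}} {H} → ((L₁ ∥ L₂) ∥ L₃) H → (L₁ ∥ (L₂ ∥ L₃)) H
  ∥-assocʳ (H₁₂ , H₃ , (H₁ , H₂ , a , b , P₁₂) , c , P) =
    let H₂₃ , P₂₃ = par-exists H₂ H₃ in H₁ , H₂₃ , a , (H₂ , H₃ , b , c , P₂₃) , par-assoc P₁₂ P P₂₃

  ∥-comm : ∀ {L₁ L₂ : Lang {T}} {H} → (L₁ ∥ L₂) H → (L₂ ∥ L₁) H
  ∥-comm (H₁ , H₂ , a , b , P) = H₂ , H₁ , b , a , par-comm P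

  ∥-mono : ∀ {L₁ L₁' L₂ L₂' : Lang {T}} → (∀ H → L₁ H → L₁' H) → (∀ H → L₂ H → L₂' H) → ∀ H → (L₁ ∥ L₂) H → (L₁' ∥ L₂') H
  ∥-mono f g H (H₁ , H₂ , a , b , P) = H₁ , H₂ , f H₁ a , g H₂ b , P

  ∥-assocˡ : ∀ {L₁ L₂ L₃ : Lang {T}} {H} → (L₁ ∥ (L₂ ∥ L₃)) H → ((L₁ ∥ L₂) ∥ L₃) H
  ∥-assocˡ {L₁} {L₂} {L₃} {H} x = ∥-mono (λ _ → ∥-comm) (λ _ → id) H (∥-comm (∥-assocʳ {L₃} {L₂} {L₁}
    (∥-mono (λ _ → ∥-comm) (λ _ → id) H (∥-comm {L₁} x))))

  uCtx₀-++ : ∀ Γ {Δ H} → uCtx₀ (Γ ++ Δ) H → (uCtx₀ Γ ∥ uCtx₀ Δ) H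
  uCtx₀-++ []      {H = H} x = ∥-comm (H , K₀ , x , K₀-empty {T} , par-K₀ H)
  uCtx₀-++ (A ∷ Γ) x = ∥-assocˡ (∥-mono (λ _ → id) (λ _ → uCtx₀-++ Γ) _ x)

  uCtx₀-swap : ∀ A B Γ {H} → uCtx₀ (A ∷ B ∷ Γ) H → uCtx₀ (B ∷ A ∷ Γ) H
  uCtx₀-swap A B Γ x = ∥-assocʳ (∥-mono (λ _ → ∥-comm {u M A} {u M B}) (λ _ → id) _ (∥-assocˡ {u M A} {u M B} {uCtx₀ Γ} x))

  uCtx₀-↭ : ∀ {Γ Δ} → Γ ↭ Δ → ∀ H → uCtx₀ Γ H → uCtx₀ Δ H
  uCtx₀-↭ Perm.refl         H x = x
  uCtx₀-↭ (Perm.prep A p)   H x = ∥-mono (λ _ → id) (uCtx₀-↭ p) H x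
  uCtx₀-↭ (Perm.swap {ys = Δ} A B p) H x =
    uCtx₀-swap A B Δ (∥-mono (λ _ → id) (∥-mono (λ _ → id) (uCtx₀-↭ p)) H x)
  uCtx₀-↭ (Perm.trans p q)  H x = uCtx₀-↭ q H (uCtx₀-↭ p H x)

  ⊨ : List (Formula 0) → Formula 0 → Set
  ⊨ Γ B = ∀ H → uCtx₀ Γ H → u M B H

_[_↦_] : (ℕ → ℕ) → ℕ → ℕ → ℕ → ℕ
(h [ y ↦ z ]) x with x ≟ℕ y
... | yes _ = z
... | no _  = h x

↦-same : ∀ h y z → (h [ y ↦ z ]) y ≡ z
↦-same h y z with y ≟ℕ y
... | yes _ = refl
... | no ¬e = ⊥-elim (¬e refl)

↦-other : ∀ h y z {x} → x ≢ y → (h [ y ↦ z ]) x ≡ h x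
↦-other h y z {x} x≢y with x ≟ℕ y
... | yes e = ⊥-elim (x≢y e)
... | no _  = refl

ren-↦ : ∀ {k} h y z (A : Formula k) → ¬ FreeIn y A → ren (h [ y ↦ z ]) A ≡ ren h A
ren-↦ h y z A y∉A = ren-cong A λ x x∈A → ↦-other h y z λ { refl → y∉A x∈A }

renCtx-↦ : ∀ h y z Γ → ¬ FreeInCtx y Γ → map (ren (h [ y ↦ z ])) Γ ≡ map (ren h) Γ
renCtx-↦ h y z []      y∉Γ = refl
renCtx-↦ h y z (A ∷ Γ) y∉Γ = cong₂ _∷_ (ren-↦ h y z A (y∉Γ ∘ here)) (renCtx-↦ h y z Γ (y∉Γ ∘ there))

-- Redirecting the eigenvariable turns the generic instance in the premise of `∃L` or `∀R` into the
-- instance at an arbitrary `z`, whatever `h` did to `y`.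
ren-inst-↦ : ∀ h y z (A : Formula 1) → ¬ FreeIn y A → ren (h [ y ↦ z ]) (inst A y) ≡ inst (ren h A) z
ren-inst-↦ h y z A y∉A = trans (ren-inst A (h [ y ↦ z ]) y) (cong₂ inst (ren-↦ h y z A y∉A) (↦-same h y z))

module _ {T : Alphabet} (M : Model T) where
  open Equivalence

  sound : ∀ {Γ B} → Γ ⊢ B → ∀ h → ⊨ M (map (ren h) Γ) (ren h B)
  sound {B = B} ax h H (H₁ , E , a , e , P) = iso-closed M (ren h B) (par-empty e P) a
  sound (cut {Γ} {Δ} d e) h H x rewrite map-++ (ren h) Γ Δ =
    sound e h H (∥-mono M (sound d h) (λ _ → id) H (uCtx₀-++ M (map (ren h) Γ) x))
  sound (exch p d) h H x = sound d h H (uCtx₀-↭ M (map⁺ (ren h) (Perm.↭-sym p)) H x)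
  sound (⊗L {A = A} {B} d) h H x =
    sound d h H (∥-assocʳ M (∥-mono M (λ K → to (u-⊗ M (ren h A) (ren h B) K)) (λ _ → id) H x))
  sound (⊗R {Γ} {Δ} {A} {B} d e) h H x rewrite map-++ (ren h) Γ Δ =
    from (u-⊗ M (ren h A) (ren h B) H) (∥-mono M (sound d h) (sound e h) H (uCtx₀-++ M (map (ren h) Γ) x))
  sound (⊸L {Γ} {Δ} {A} {B} d e) h H x rewrite map-++ (ren h) Γ Δ
    with ∥-assocˡ M {u M (ren h (A ⊸ B))} (∥-mono M (λ _ → id) (λ _ → uCtx₀-++ M (map (ren h) Γ)) H x)
  ... | K , H₃ , (H₁ , H₂ , f , a , P) , c , Q =
    sound e h H (K , H₃ , to (u-⊸ M (ren h A) (ren h B) H₁) f H₂ K (sound d h H₂ a) P , c , Q)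
  sound (⊸R {A = A} {B} d) h H x = from (u-⊸ M (ren h A) (ren h B) H) λ H' K a P →
    sound d h K (H' , H , a , x , par-comm P)
  sound {B = C} (∃L {Γ} {A} y d y∉Γ y∉C y∉A) h H (H₁ , H₂ , a , b , P) with to (u-∃ M (ren h A) H₁) a
  ... | z , a' = subst (λ C → u M C H) (ren-↦ h y z C y∉C) (sound d (h [ y ↦ z ]) H
    (H₁ , H₂ , subst (λ A → u M A H₁) (sym (ren-inst-↦ h y z A y∉A)) a' ,
     subst (λ Γ → uCtx₀ M Γ H₂) (sym (renCtx-↦ h y z Γ y∉Γ)) b , P))
  sound (∃R {A = A} y d) h H x = from (u-∃ M (ren h A) H)
    (h y , subst (λ A → u M A H) (ren-inst A h y) (sound d h H x))
  sound (∀L {A = A} y d) h H (H₁ , H₂ , a , b , P) = sound d h H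
    (H₁ , H₂ , subst (λ A → u M A H₁) (sym (ren-inst A h y)) (to (u-∀ M (ren h A) H₁) a (h y)) , b , P)
  sound (∀R {Γ} {A} y d y∉Γ y∉A) h H x = from (u-∀ M (ren h A) H) λ z →
    subst (λ A → u M A H) (ren-inst-↦ h y z A y∉A)
      (sound d (h [ y ↦ z ]) H (subst (λ Γ → uCtx₀ M Γ H) (sym (renCtx-↦ h y z Γ y∉Γ)) x))

renCtx-id : (Γ : List (Formula 0)) → map (ren id) Γ ≡ Γ
renCtx-id []      = refl
renCtx-id (A ∷ Γ) = cong₂ _∷_ (ren-id A) (renCtx-id Γ)

soundness : ∀ (T : Alphabet) (M : Model T) Γ B → Γ ⊢ B → TrueIn M Γ B
soundness T M Γ B d H x = subst (λ B → u M B H) (ren-id B)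
  (sound M d id H (subst (λ Γ → uCtx₀ M Γ H) (sym (renCtx-id Γ)) (uCtx⇒uCtx₀ M Γ H x)))

-- Forcing

tabulate-insert : ∀ {X : Set} {n} (f : Fin (suc n) → X) j → tabulate f ↭ f j ∷ tabulate (f ∘ punchIn j)
tabulate-insert f zero = Perm.refl
tabulate-insert {n = suc n} f (suc j) =
  Perm.trans (Perm.prep _ (tabulate-insert (f ∘ suc) j)) (Perm.swap _ _ Perm.refl)

-- Bijections between hyperedges thus become permutations of contexts, which `exch` absorbs. The
-- induction removes index `zero` together with its image.
tabulate-permute : ∀ {X : Set} {m n} (κ : Fin m ↔ Fin n) (f : Fin n → X) → tabulate f ↭ tabulate (f ∘ Inverse.to κ)
tabulate-permute {m = zero}  {zero}  κ f = Perm.refl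
tabulate-permute {m = zero}  {suc n} κ f with () ← Inverse.from κ zero
tabulate-permute {m = suc m} {zero}  κ f with () ← Inverse.to κ zero
tabulate-permute {m = suc m} {suc n} κ f =
  Perm.trans (tabulate-insert f (Inverse.to κ zero))
    (Perm.prep _ (Perm.trans (tabulate-permute (remove zero κ) _)
      (↭-reflexive (tabulate-cong λ i → cong f (sym (punchIn-permute κ zero i))))))

tabulate-++ : ∀ {X : Set} m {n} (f : Fin (m + n) → X) → tabulate f ≡ tabulate (f ∘ (_↑ˡ n)) ++ tabulate (f ∘ (m ↑ʳ_))
tabulate-++ zero    f = refl
tabulate-++ (suc m) f = cong (_ ∷_) (tabulate-++ m (f ∘ suc))

tabulate-⊎ : ∀ {X : Set} {m n o} (κ : (Fin m ⊎ Fin n) ↔ Fin o) (f : Fin o → X) →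
             tabulate f ↭ tabulate (f ∘ Inverse.to κ ∘ inj₁) ++ tabulate (f ∘ Inverse.to κ ∘ inj₂)
tabulate-⊎ {m = m} {n} κ f = Perm.trans (tabulate-permute (κ ↔-∘ +↔⊎) f)
  (↭-reflexive (trans (tabulate-++ m _) (cong₂ _++_
    (tabulate-cong λ i → cong (f ∘ Inverse.to κ) (splitAt-join m n (inj₁ i)))
    (tabulate-cong λ i → cong (f ∘ Inverse.to κ) (splitAt-join m n (inj₂ i))))))

-- A formula with its bound variables attached to elements of X: a labelled hyperedge.
Edge : Set → Set
Edge X = Σ (Σ ℕ Formula) λ l → Vec X (proj₁ l)

mapE : ∀ {X Y : Set} → (X → Y) → Edge X → Edge Y
mapE f (l , xs) = l , Vec.map f xs

mapE-cong : ∀ {X Y : Set} {f g : X → Y} → f ≗ g → mapE f ≗ mapE g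
mapE-cong e (l , xs) = cong (l ,_) (Vec.map-cong e xs)

mapE-id : ∀ {X : Set} {f : X → X} → f ≗ id → mapE f ≗ id
mapE-id e (l , xs) = cong (l ,_) (trans (Vec.map-cong e xs) (Vec.map-id xs))

mapE-∘ : ∀ {X Y Z : Set} (f : Y → Z) (g : X → Y) e → mapE (f ∘ g) e ≡ mapE f (mapE g e)
mapE-∘ f g (l , xs) = cong (l ,_) (Vec.map-∘ f g xs)

mapE-fuse : ∀ {X Y Z : Set} {f : Y → Z} {g : X → Y} {h : X → Z} → (∀ x → f (g x) ≡ h x) → ∀ e → mapE f (mapE g e) ≡ mapE h e
mapE-fuse {f = f} {g} eq e = trans (sym (mapE-∘ f g e)) (mapE-cong eq e)

Edge-≡ : ∀ {X : Set} {l l'} {xs : Vec X (proj₁ l)} {ys : Vec X (proj₁ l')} →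
         _≡_ {A = Edge X} (l , xs) (l' , ys) → Σ (l ≡ l') λ e → subst (λ l → Vec X (proj₁ l)) e xs ≡ ys
Edge-≡ refl = refl , refl

-- Attachments are compared position by position, since no map between `X` and `Y` is at hand
-- through which one side would factor.
mapE-transfer : ∀ {X Y Z W : Set} {f : X → Z} {g : Y → Z} {f' : X → W} {g' : Y → W} (e : Edge X) (e' : Edge Y) →
                mapE f e ≡ mapE g e' → (∀ x y → f x ≡ g y → f' x ≡ g' y) → mapE f' e ≡ mapE g' e'
mapE-transfer {f = f} {g} {f'} {g'} (l , xs) (l' , ys) eq imp with Edge-≡ eq
... | refl , eqs = cong (l ,_) (go xs ys eqs)
  where
  go : ∀ {n} (xs : Vec _ n) (ys : Vec _ n) → Vec.map f xs ≡ Vec.map g ys → Vec.map f' xs ≡ Vec.map g' ys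
  go []       []       _ = refl
  go (x ∷ xs) (y ∷ ys) e = cong₂ _∷_ (imp x y (Vec.∷-injectiveˡ e)) (go xs ys (Vec.∷-injectiveʳ e))

-- Lifting a hyperedge along `emb` takes preimages only of the nodes attached to it, and each of
-- these is matched with a position of `e'`.
mapE-section : ∀ {X Y Z W : Set} {f : X → Z} {g : Y → Z} {emb : W → X} (e : Edge X) (e' : Edge Y) →
               mapE f e ≡ mapE g e' → (∀ x y → f x ≡ g y → ∃ λ a → emb a ≡ x) → ∃ λ e'' → mapE emb e'' ≡ e
mapE-section {f = f} {g} {emb} (l , xs) (l' , ys) eq sec with Edge-≡ eq
... | refl , eqs = let zs , r = go xs ys eqs in (l , zs) , cong (l ,_) r
  where
  go : ∀ {n} (xs : Vec _ n) (ys : Vec _ n) → Vec.map f xs ≡ Vec.map g ys → ∃ λ zs → Vec.map emb zs ≡ xs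
  go []       []       _ = [] , refl
  go (x ∷ xs) (y ∷ ys) e =
    let a , r = sec x y (Vec.∷-injectiveˡ e)
        zs , rs = go xs ys (Vec.∷-injectiveʳ e)
    in a ∷ zs , cong₂ _∷_ r rs

-- States, their renamings and their morphisms

tmap : ∀ {m n} → (ℕ → ℕ) → (Fin m → Fin n) → Term m → Term n
tmap γ π (free x)  = free (γ x)
tmap γ π (bound i) = bound (π i)

tmap-∘ : ∀ {m n o} γ (π : Fin n → Fin o) γ' (π' : Fin m → Fin n) t → tmap γ π (tmap γ' π' t) ≡ tmap (γ ∘ γ') (π ∘ π') t
tmap-∘ γ π γ' π' (free x)  = refl
tmap-∘ γ π γ' π' (bound i) = refl

tmap-id : ∀ {n} (t : Term n) → tmap id id t ≡ t
tmap-id (free x)  = refl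
tmap-id (bound i) = refl

name : ∀ {n} → (ℕ → ℕ) → (Fin n → ℕ) → Term n → ℕ
name γ s (free x)  = γ x
name γ s (bound i) = s i

name-tmap : ∀ {m n} γ (s : Fin n → ℕ) γ' (π : Fin m → Fin n) t → name γ s (tmap γ' π t) ≡ name (γ ∘ γ') (s ∘ π) t
name-tmap γ s γ' π (free x)  = refl
name-tmap γ s γ' π (bound i) = refl

-- A hypergraph all of whose external nodes are denoted by names: free x is the
-- external node x, the de Bruijn indices are the internal nodes.
record State : Set where
  field
    nI   : ℕ
    nEd  : ℕ
    edge : Fin nEd → Edge (Term nI)

open State

rename : (ℕ → ℕ) → State → State
rename γ S = record { nI = nI S ; nEd = nEd S ; edge = mapE (tmap γ id) ∘ edge S }

-- `γ` may fuse external nodes, as `sub` does, whereas internal nodes stay distinct. The target may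
-- have further internal nodes, but they are isolated because `κ` is a bijection, so they carry no
-- formula.
record Mor (γ : ℕ → ℕ) (S S' : State) : Set where
  field
    π     : Fin (nI S) → Fin (nI S')
    π-inj : ∀ {i j} → π i ≡ π j → i ≡ j
    κ     : Fin (nEd S) ↔ Fin (nEd S')
    edge≡ : ∀ j → edge S' (Inverse.to κ j) ≡ mapE (tmap γ π) (edge S j)

-- Only the first factor is renamed: in the ⊸ clause of forcing it is the current state, moved along
-- a later renaming before the argument is added.
record Join (γ : ℕ → ℕ) (S₁ S₂ S : State) : Set where
  field
    π      : Fin (nI S₁) ⊎ Fin (nI S₂) → Fin (nI S)
    π-inj  : ∀ {i j} → π i ≡ π j → i ≡ j
    κ      : (Fin (nEd S₁) ⊎ Fin (nEd S₂)) ↔ Fin (nEd S)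
    edge₁≡ : ∀ j → edge S (Inverse.to κ (inj₁ j)) ≡ mapE (tmap γ (π ∘ inj₁)) (edge S₁ j)
    edge₂≡ : ∀ j → edge S (Inverse.to κ (inj₂ j)) ≡ mapE (tmap id (π ∘ inj₂)) (edge S₂ j)

mor-id : ∀ {S} → Mor id S S
mor-id {S} = record { π = id ; π-inj = id ; κ = ↔-id _ ; edge≡ = λ j → sym (mapE-id tmap-id (edge S j)) }

mor-rename : ∀ γ S → Mor γ S (rename γ S)
mor-rename γ S = record { π = id ; π-inj = id ; κ = ↔-id _ ; edge≡ = λ _ → refl }

mor-rename₂ : ∀ {γ S S'} γ' → Mor γ S S' → Mor id (rename (γ' ∘ γ) S) (rename γ' S')
mor-rename₂ {γ} {S} γ' m = record { π = π ; π-inj = π-inj ; κ = κ ; edge≡ = λ j →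
    trans (cong (mapE _) (edge≡ j)) (trans (mapE-fuse (tmap-∘ _ _ _ _) (edge S j))
      (sym (mapE-fuse (tmap-∘ _ _ _ _) (edge S j)))) }
  where open Mor m

join-mor : ∀ {γ γ' S S' S₂ S₃} → Mor γ S S' → Join γ' S' S₂ S₃ → Join (γ' ∘ γ) S S₂ S₃
join-mor {γ} {γ'} {S} {S'} {S₂} {S₃} m J = record
  { π = π' ; π-inj = inj ; κ = J.κ ↔-∘ (m.κ ⊎-↔ ↔-id _)
  ; edge₁≡ = λ j → trans (J.edge₁≡ _) (trans (cong (mapE _) (m.edge≡ j)) (mapE-fuse (tmap-∘ _ _ _ _) (edge S j)))
  ; edge₂≡ = J.edge₂≡ }
  where
  module m = Mor m
  module J = Join J
  π' : Fin (nI S) ⊎ Fin (nI S₂) → Fin (nI S₃)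
  π' = J.π ∘ [ inj₁ ∘ m.π , inj₂ ]
  inj : ∀ {i j} → π' i ≡ π' j → i ≡ j
  inj {inj₁ i} {inj₁ j} e = cong inj₁ (m.π-inj (inj₁-injective (J.π-inj e)))
  inj {inj₁ i} {inj₂ j} e with () ← J.π-inj e
  inj {inj₂ i} {inj₁ j} e with () ← J.π-inj e
  inj {inj₂ i} {inj₂ j} e with refl ← J.π-inj e = refl

mor-join : ∀ {γ S S' S₁ S₂} → Join id S₁ S₂ S → Mor γ S S' → Join id (rename γ S₁) (rename γ S₂) S'
mor-join {γ} {S} {S'} {S₁} {S₂} J m = record
  { π = m.π ∘ J.π ; π-inj = J.π-inj ∘ m.π-inj ; κ = m.κ ↔-∘ J.κ
  ; edge₁≡ = λ j → trans (m.edge≡ _) (trans (cong (mapE _) (J.edge₁≡ j)) (fuse (edge S₁ j)))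
  ; edge₂≡ = λ j → trans (m.edge≡ _) (trans (cong (mapE _) (J.edge₂≡ j)) (fuse (edge S₂ j))) }
  where
  module m = Mor m
  module J = Join J
  fuse : ∀ {n} {π' : Fin n → Fin (nI S)} e → mapE (tmap γ m.π) (mapE (tmap id π') e) ≡ mapE (tmap id (m.π ∘ π')) (mapE (tmap γ id) e)
  fuse e = trans (mapE-fuse (tmap-∘ _ _ _ _) e) (sym (mapE-fuse (tmap-∘ _ _ _ _) e))

join-rename : ∀ {γ S₁ S₂ S} → Join γ S₁ S₂ S → Join id (rename γ S₁) S₂ S
join-rename {S₁ = S₁} J = record { π = π ; π-inj = π-inj ; κ = κ
  ; edge₁≡ = λ j → trans (edge₁≡ j) (sym (mapE-fuse (tmap-∘ _ _ _ _) (edge S₁ j))) ; edge₂≡ = edge₂≡ }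
  where open Join J

reify : Edge ℕ → Formula 0
reify ((k , φ) , xs) = subF (free ∘ lookup xs) φ

formulas : (S : State) → (ℕ → ℕ) → (Fin (nI S) → ℕ) → List (Formula 0)
formulas S γ s = tabulate (reify ∘ mapE (name γ s) ∘ edge S)

formulas-mor : ∀ {γ S S'} (m : Mor γ S S') γ' s → formulas S' γ' s ↭ formulas S (γ' ∘ γ) (s ∘ Mor.π m)
formulas-mor {S = S} m γ' s = Perm.trans (tabulate-permute κ _) (↭-reflexive (tabulate-cong λ j →
    cong reify (trans (cong (mapE _) (edge≡ j)) (mapE-fuse (name-tmap _ _ _ _) (edge S j)))))
  where open Mor m

formulas-join : ∀ {γ S₁ S₂ S} (J : Join γ S₁ S₂ S) γ' s →
                formulas S γ' s ↭ formulas S₁ (γ' ∘ γ) (s ∘ Join.π J ∘ inj₁) ++ formulas S₂ γ' (s ∘ Join.π J ∘ inj₂)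
formulas-join {S₁ = S₁} {S₂} J γ' s = Perm.trans (tabulate-⊎ κ _) (↭-reflexive (cong₂ _++_
  (tabulate-cong λ j → cong reify (trans (cong (mapE _) (edge₁≡ j)) (mapE-fuse (name-tmap _ _ _ _) (edge S₁ j))))
  (tabulate-cong λ j → cong reify (trans (cong (mapE _) (edge₂≡ j)) (mapE-fuse (name-tmap _ _ _ _) (edge S₂ j))))))
  where open Join J

-- The quantification over later renamings γ makes forcing closed under renaming for all
-- formulas, including those with ⊗ and ex.
Forces : ∀ {k} → Formula k → (ℕ → ℕ) → (Fin k → ℕ) → State → Set
Forces (atom p xs) β ε S = ∀ γ s → formulas S γ s ⊢ ⟦ atom p xs ⟧ (γ ∘ β) (γ ∘ ε)
Forces (A ⊗ B) β ε S = ∃ λ S₁ → ∃ λ S₂ → Join id S₁ S₂ S × Forces A β ε S₁ × Forces B β ε S₂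
Forces (A ⊸ B) β ε S = ∀ γ S₁ S₂ → Join γ S S₁ S₂ → Forces A (γ ∘ β) (γ ∘ ε) S₁ → Forces B (γ ∘ β) (γ ∘ ε) S₂
Forces (ex A)  β ε S = ∃ λ y → Forces A β (y ▹ ε) S
Forces (all A) β ε S = ∀ γ y → Forces A (γ ∘ β) (y ▹ (γ ∘ ε)) (rename γ S)

▹-cong : ∀ {k} {ε ε' : Fin k → ℕ} {y y'} → y ≡ y' → ε ≗ ε' → y ▹ ε ≗ y' ▹ ε'
▹-cong e e' zero    = e
▹-cong e e' (suc i) = e' i

⟦⟧-cong : ∀ {k} (A : Formula k) {β β' ε ε'} → (∀ x → FreeIn x A → β x ≡ β' x) → ε ≗ ε' → ⟦ A ⟧ β ε ≡ ⟦ A ⟧ β' ε'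
⟦⟧-cong A e e' = sub₂-cong A (λ x → cong free ∘ e x) (λ i → cong free (e' i))

⊢-subst : ∀ {Γ A B} → A ≡ B → Γ ⊢ A → Γ ⊢ B
⊢-subst refl d = d

-- Kripke monotonicity: a later renaming `γ'` of `S'` is the later renaming `γ' ∘ γ` of `S`, while ⊗
-- and `ex` transport their witnesses. Agreement on the free names of `A` is what finitely many
-- selectors can guarantee.
Forces-mor : ∀ {k} (A : Formula k) {γ β ε β' ε' S S'} → Mor γ S S' →
        (∀ x → FreeIn x A → γ (β x) ≡ β' x) → (∀ i → γ (ε i) ≡ ε' i) → Forces A β ε S → Forces A β' ε' S'
Forces-mor (atom p xs) {γ} m e e' f γ' s =
  exch (↭-sym (formulas-mor m γ' s)) (⊢-subst
    (⟦⟧-cong (atom p xs) (λ x → cong γ' ∘ e x) (λ i → cong γ' (e' i))) (f (γ' ∘ γ) _))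
Forces-mor (A ⊗ B) {γ} m e e' (S₁ , S₂ , J , a , b) = rename γ S₁ , rename γ S₂ , mor-join J m ,
  Forces-mor A (mor-rename γ S₁) (λ x → e x ∘ ⊗ˡ) e' a , Forces-mor B (mor-rename γ S₂) (λ x → e x ∘ ⊗ʳ) e' b
Forces-mor (A ⊸ B) {γ} m e e' f γ' S₁ S₂ J a =
  Forces-mor B mor-id (λ x → cong γ' ∘ e x ∘ ⊸ʳ) (λ i → cong γ' (e' i)) (f (γ' ∘ γ) S₁ S₂ (join-mor m J)
    (Forces-mor A mor-id (λ x → sym ∘ cong γ' ∘ e x ∘ ⊸ˡ) (λ i → sym (cong γ' (e' i))) a))
Forces-mor (ex A) {γ} m e e' (y , a) = γ y , Forces-mor A m (λ x → e x ∘ exF) (λ { zero → refl ; (suc i) → e' i }) a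
Forces-mor (all A) {γ} m e e' f γ' y = Forces-mor A (mor-rename₂ γ' m) (λ x → cong γ' ∘ e x ∘ allF)
  (▹-cong refl (λ i → cong γ' (e' i))) (f (γ' ∘ γ) y)

name-weakenT : ∀ {j} β (ε : Fin j → ℕ) y t → name β (y ▹ ε) (weakenT t) ≡ name β ε t
name-weakenT β ε y (free x)  = refl
name-weakenT β ε y (bound i) = refl

name-liftS : ∀ {k j} β (ε : Fin j → ℕ) {ε' : Fin k → ℕ} y (s : Fin k → Term j) → (∀ i → name β ε (s i) ≡ ε' i) →
             ∀ i → name β (y ▹ ε) (liftS s i) ≡ (y ▹ ε') i
name-liftS β ε y s e zero    = refl
name-liftS β ε y s e (suc i) = trans (name-weakenT β ε y (s i)) (e i)

name-∘ : ∀ {j} γ β (ε : Fin j → ℕ) t → name (γ ∘ β) (γ ∘ ε) t ≡ γ (name β ε t)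
name-∘ γ β ε (free x)  = refl
name-∘ γ β ε (bound i) = refl

sub₂T-free : ∀ {j} (β : ℕ → ℕ) (ε : Fin j → ℕ) t → sub₂T (free ∘ β) (free ∘ ε) t ≡ free {0} (name β ε t)
sub₂T-free β ε (free x)  = refl
sub₂T-free β ε (bound i) = refl

⟦⟧-sub₂ : ∀ {k j} (A : Formula k) (f : ℕ → Term j) (s : Fin k → Term j) {β ε β' ε'} →
          (∀ x → name β ε (f x) ≡ β' x) → (∀ i → name β ε (s i) ≡ ε' i) →
          ⟦ sub₂ f s A ⟧ β ε ≡ ⟦ A ⟧ β' ε'
⟦⟧-sub₂ A f s e e' = trans (sub₂-∘ _ _ _ _ A) (sub₂-cong A
  (λ x _ → trans (sub₂T-free _ _ (f x)) (cong free (e x))) (λ i → trans (sub₂T-free _ _ (s i)) (cong free (e' i))))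

-- The substitution lemma for forcing. Both directions are proved together because ⊸ is
-- contravariant in its antecedent.
Forces-sub₂ : ∀ {k j} (A : Formula k) (f : ℕ → Term j) (s : Fin k → Term j) {β ε β' ε' S} →
         (∀ x → name β ε (f x) ≡ β' x) → (∀ i → name β ε (s i) ≡ ε' i) →
         Forces (sub₂ f s A) β ε S ⇔ Forces A β' ε' S
Forces-sub₂ (atom p xs) f s {β} {ε} e e' = mk⇔ (λ a γ s → ⊢-subst (eq γ) (a γ s)) (λ a γ s → ⊢-subst (sym (eq γ)) (a γ s))
  where
  eq : ∀ γ → ⟦ sub₂ f s (atom p xs) ⟧ (γ ∘ β) (γ ∘ ε) ≡ ⟦ atom p xs ⟧ (γ ∘ _) (γ ∘ _)
  eq γ = ⟦⟧-sub₂ (atom p xs) f s (λ x → trans (name-∘ γ β ε (f x)) (cong γ (e x)))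
                                 (λ i → trans (name-∘ γ β ε (s i)) (cong γ (e' i)))
Forces-sub₂ (A ⊗ B) f s e e' = mk⇔
  (λ (S₁ , S₂ , J , a , b) → S₁ , S₂ , J , Equivalence.to (Forces-sub₂ A f s e e') a , Equivalence.to (Forces-sub₂ B f s e e') b)
  (λ (S₁ , S₂ , J , a , b) → S₁ , S₂ , J , Equivalence.from (Forces-sub₂ A f s e e') a , Equivalence.from (Forces-sub₂ B f s e e') b)
Forces-sub₂ (A ⊸ B) f s {β} {ε} e e' = mk⇔
  (λ h γ S₁ S₂ J a → Equivalence.to (Forces-sub₂ B f s (eβ γ) (eε γ)) (h γ S₁ S₂ J (Equivalence.from (Forces-sub₂ A f s (eβ γ) (eε γ)) a)))
  (λ h γ S₁ S₂ J a → Equivalence.from (Forces-sub₂ B f s (eβ γ) (eε γ)) (h γ S₁ S₂ J (Equivalence.to (Forces-sub₂ A f s (eβ γ) (eε γ)) a)))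
  where
  eβ : ∀ γ x → name (γ ∘ β) (γ ∘ ε) (f x) ≡ γ _
  eβ γ x = trans (name-∘ γ β ε (f x)) (cong γ (e x))
  eε : ∀ γ i → name (γ ∘ β) (γ ∘ ε) (s i) ≡ γ _
  eε γ i = trans (name-∘ γ β ε (s i)) (cong γ (e' i))
Forces-sub₂ (ex A) f s {β} {ε} e e' = mk⇔
  (λ (y , a) → y , Equivalence.to (rec y) a) (λ (y , a) → y , Equivalence.from (rec y) a)
  where
  rec : ∀ y {S} → Forces (sub₂ (weakenT ∘ f) (liftS s) A) β (y ▹ ε) S ⇔ Forces A _ (y ▹ _) S
  rec y = Forces-sub₂ A _ _ (λ x → trans (name-weakenT β ε y (f x)) (e x)) (name-liftS β ε y s e')
Forces-sub₂ (all A) f s {β} {ε} e e' = mk⇔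
  (λ a γ y → Equivalence.to (rec γ y) (a γ y)) (λ a γ y → Equivalence.from (rec γ y) (a γ y))
  where
  rec : ∀ γ y {S} → Forces (sub₂ (weakenT ∘ f) (liftS s) A) (γ ∘ β) (y ▹ (γ ∘ ε)) S ⇔ Forces A (γ ∘ _) (y ▹ (γ ∘ _)) S
  rec γ y = Forces-sub₂ A _ _ (λ x → trans (name-weakenT _ _ y (f x)) (trans (name-∘ γ β ε (f x)) (cong γ (e x))))
    (name-liftS _ _ y s (λ i → trans (name-∘ γ β ε (s i)) (cong γ (e' i))))

Forces-ren : (A : Formula 0) → ∀ h {β ε ε' S} → Forces (ren h A) β ε S ⇔ Forces A (β ∘ h) ε' S
Forces-ren A h {β} {ε} {ε'} {S} = subst (λ C → Forces C β ε S ⇔ Forces A (β ∘ h) ε' S) (sym (ren-sub₂ h A)) (Forces-sub₂ A _ _ (λ _ → refl) (λ ()))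

Forces-inst : (A : Formula 1) → ∀ y {β ε ε' S} → Forces (inst A y) β ε S ⇔ Forces A β (β y ▹ ε') S
Forces-inst A y {β} {ε} {ε'} {S} = subst (λ C → Forces C β ε S ⇔ Forces A β (β y ▹ ε') S) (sym (subF-sub₂ (openS y) A)) (Forces-sub₂ A _ _ (λ _ → refl) (λ { zero → refl }))

-- Forcing and derivability on the fragment

formulaEdge : Formula 0 → Edge (Term 0)
formulaEdge A = (boundF A , abstractF A) , Vec.tabulate (free ∘ toℕ)

-- Attachment `i` of the hyperedge is the name `i`, so renaming the attachments by `γ` and filling
-- them in undoes the abstraction.
reify-formulaEdge : ∀ {n} A γ (s : Fin n → ℕ) (π : Fin 0 → Fin n) →
                    reify (mapE (name γ s) (mapE (tmap id π) (formulaEdge A))) ≡ ⟦ A ⟧ γ (λ ())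
reify-formulaEdge A γ s π = trans (trans (subF-sub₂ _ (abstractF A))
  (trans (sub₂-cong (abstractF A) (λ _ _ → refl) eq) (sym (subF-sub₂ _ (abstractF A))))) (subF-abstractF A γ)
  where
  names : Vec (Term 0) (boundF A)
  names = Vec.tabulate (free ∘ toℕ)
  eq : ∀ i → free (lookup (Vec.map (name γ s) (Vec.map (tmap id π) names)) i) ≡ free (γ (toℕ i))
  eq i = cong free (trans (Vec.lookup-map i (name γ s) (Vec.map (tmap id π) names)) (cong (name γ s)
    (trans (Vec.lookup-map i (tmap id π) names) (cong (tmap id π) (Vec.lookup∘tabulate (free ∘ toℕ) i)))))

formulaState : Formula 0 → State
formulaState A = record { nI = 0 ; nEd = 1 ; edge = λ _ → mapE (tmap id id) (formulaEdge A) }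

-- The extension of the renamed `S` by a hypothesis `A`; its context is that of the premise of `⊸R`.
adjoin : (ℕ → ℕ) → State → Formula 0 → State
adjoin γ S A = record { nI = nI S ; nEd = suc (nEd S) ; edge = edges }
  where
  edges : Fin (suc (nEd S)) → Edge (Term (nI S))
  edges zero    = mapE (tmap id (λ ())) (formulaEdge A)
  edges (suc j) = mapE (tmap γ id) (edge S j)

adjoin-join : ∀ γ S A → Join γ S (formulaState A) (adjoin γ S A)
adjoin-join γ S A = record
  { π = [ id , (λ ()) ] ; π-inj = λ { {inj₁ i} {inj₁ j} e → cong inj₁ e }
  ; κ = mk↔ₛ′ to from (λ { zero → refl ; (suc _) → refl }) (λ { (inj₁ _) → refl ; (inj₂ zero) → refl })
  ; edge₁≡ = λ _ → refl
  ; edge₂≡ = λ { zero → sym (mapE-fuse (λ { (free _) → refl }) (formulaEdge A)) } }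
  where
  to : Fin (nEd S) ⊎ Fin 1 → Fin (suc (nEd S))
  to (inj₁ j) = suc j
  to (inj₂ _) = zero
  from : Fin (suc (nEd S)) → Fin (nEd S) ⊎ Fin 1
  from zero    = inj₂ zero
  from (suc j) = inj₁ j

formulas-adjoin : ∀ γ S A s → formulas (adjoin γ S A) id s ≡ A ∷ formulas S γ s
formulas-adjoin γ S A s = cong₂ _∷_ (trans (reify-formulaEdge A id s (λ ())) (sub₂-id A))
  (tabulate-cong λ j → cong reify (mapE-fuse (name-tmap _ _ _ _) (edge S j)))

formulas-formulaState : ∀ A γ s → formulas (formulaState A) γ s ≡ ⟦ A ⟧ γ (λ ()) ∷ []
formulas-formulaState A γ s = cong (_∷ []) (reify-formulaEdge A γ s id)

cut-⊸ : ∀ {Γ Δ A B} → Γ ⊢ A ⊸ B → Δ ⊢ A → Γ ++ Δ ⊢ B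
cut-⊸ {Γ} {Δ} d e = cut d (subst (λ Δ → _ ∷ Δ ⊢ _) (++-identityʳ Δ) (⊸L e ax))

mutual
  -- For ⊸ the generic argument is the state made of the antecedent alone, which forces the
  -- antecedent by the converse direction applied to `ax`; hence the mutual induction. For `all` the
  -- generic argument is a fresh name.
  Forces⇒⊢ : ∀ {k} {A : Formula k} → ImpAll A → ∀ {β ε S} → Forces A β ε S → ∀ γ s → formulas S γ s ⊢ ⟦ A ⟧ (γ ∘ β) (γ ∘ ε)
  Forces⇒⊢ atomI f γ s = f γ s
  Forces⇒⊢ (⊸I {A} {B} a b) {β} {ε} {S} f γ s = ⊸R (subst (_⊢ ⟦ B ⟧ (γ ∘ β) (γ ∘ ε)) (formulas-adjoin γ S Q s)
      (Forces⇒⊢ b (f γ (formulaState Q) (adjoin γ S Q) (adjoin-join γ S Q) (⊢⇒Forces a λ γ' s' →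
        subst₂ _⊢_ (sym (formulas-formulaState Q γ' s')) (⟦⟧-sub₂ A _ _ (λ _ → refl) (λ _ → refl)) ax)) id s))
    where
    Q = ⟦ A ⟧ (γ ∘ β) (γ ∘ ε)
  Forces⇒⊢ (allI {A} a) {β} {ε} {S} f γ s = ∀R y
      (subst₂ _⊢_ (tabulate-cong λ j → cong reify (mapE-fuse (name-tmap _ _ _ _) (edge S j)))
        (trans (⟦⟧-cong A (λ _ _ → refl) (λ { zero → refl ; (suc i) → refl })) (sym (inst-⟦⟧ A (γ ∘ β) (γ ∘ ε) y)))
        (Forces⇒⊢ a (f γ y) id s))
      (λ y∈Γ → <⇒≱ (freeCtx<bound _ y∈Γ) (m≤m⊔n (boundCtx Γ) (boundF C)))
      (λ y∈C → <⇒≱ (free<bound y∈C) (m≤n⊔m (boundCtx Γ) (boundF C)))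
    where
    Γ = formulas S γ s
    C = sub₂ (weakenT ∘ free ∘ γ ∘ β) (liftS (free ∘ γ ∘ ε)) A
    -- Both bounds are strict, so this is an admissible eigenvariable for `Γ` and `C`.
    y = boundCtx Γ ⊔ boundF C

  -- The right rules are inverted by cuts: ⊸ against a derivation from the other half of the join,
  -- `all` against the instance given by `∀L`.
  ⊢⇒Forces : ∀ {k} {A : Formula k} → ImpAll A → ∀ {β ε S} → (∀ γ s → formulas S γ s ⊢ ⟦ A ⟧ (γ ∘ β) (γ ∘ ε)) → Forces A β ε S
  ⊢⇒Forces atomI d = d
  ⊢⇒Forces (⊸I {A} {B} a b) d γ S₁ S₂ J fa = ⊢⇒Forces b λ γ' s →
    exch (↭-sym (formulas-join J γ' s)) (cut-⊸ (d (γ' ∘ γ) _) (Forces⇒⊢ a fa γ' _))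
  ⊢⇒Forces (allI {A} a) {β} {ε} {S} d γ y = ⊢⇒Forces a λ γ' s →
    subst₂ _⊢_ (trans (++-identityʳ _) (tabulate-cong λ j → cong reify (sym (mapE-fuse (name-tmap _ _ _ _) (edge S j)))))
      (trans (inst-⟦⟧ A (γ' ∘ γ ∘ β) (γ' ∘ γ ∘ ε) (γ' y)) (⟦⟧-cong A (λ _ _ → refl) (λ { zero → refl ; (suc i) → refl })))
      (cut (d (γ' ∘ γ) s) (∀L (γ' y) ax))

open State

-- The canonical model

canonical : Alphabet
canonical = record
  { Lab = Σ ℕ Formula
  ; type = λ l σ → does (σ <? proj₁ l)
  ; typeFin = λ l → proj₁ l , λ σ k≤σ → dec-false (σ <? proj₁ l) λ σ<k → <⇒≱ σ<k k≤σ }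

Hyp : Set
Hyp = Hypergraph canonical

-- Hyperedges as labelled vectors of nodes

fromIsJust : ∀ {X : Set} (m : Maybe X) → is-just m ≡ true → X
fromIsJust (just x) _ = x

fromIsJust-just : ∀ {X : Set} (m : Maybe X) p → m ≡ just (fromIsJust m p)
fromIsJust-just (just x) _ = refl

is-just-false : ∀ {X : Set} (m : Maybe X) → is-just m ≡ false → m ≡ nothing
is-just-false nothing _ = refl

isJust-att : (H : Hyp) → ∀ e (i : Fin (proj₁ (lab H e))) → is-just (att H e (toℕ i)) ≡ true
isJust-att H e i = trans (att-dom H e (toℕ i)) (dec-true (toℕ i <? _) (toℕ<n i))

attach : (H : Hyp) → ∀ e → Fin (proj₁ (lab H e)) → Fin (nV H)
attach H e i = fromIsJust (att H e (toℕ i)) (isJust-att H e i)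

hyperedge : (H : Hyp) → Fin (nE H) → Edge (Fin (nV H))
hyperedge H e = lab H e , Vec.tabulate (attach H e)

attOf : ∀ {X : Set} → Edge X → ℕ → Maybe X
attOf (l , xs) σ with σ <? proj₁ l
... | yes σ<k = just (lookup xs (fromℕ< σ<k))
... | no _    = nothing

attOf-dom : ∀ {X : Set} (e : Edge X) σ → is-just (attOf e σ) ≡ type canonical (proj₁ e) σ
attOf-dom (l , xs) σ with σ <? proj₁ l
... | yes σ<k = sym (dec-true (σ <? proj₁ l) σ<k)
... | no σ≮k  = sym (dec-false (σ <? proj₁ l) σ≮k)

attOf-map : ∀ {X Y : Set} (f : X → Y) e σ → attOf (mapE f e) σ ≡ Maybe.map f (attOf e σ)
attOf-map f (l , xs) σ with σ <? proj₁ l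
... | yes σ<k = cong just (Vec.lookup-map (fromℕ< σ<k) f xs)
... | no _    = refl

att-attOf : (H : Hyp) → ∀ e σ → att H e σ ≡ attOf (hyperedge H e) σ
att-attOf H e σ with σ <? proj₁ (lab H e)
... | no σ≮k  = is-just-false _ (trans (att-dom H e σ) (dec-false (σ <? _) σ≮k))
... | yes σ<k = begin
  att H e σ                           ≡⟨ cong (att H e) (toℕ-fromℕ< σ<k) ⟨
  att H e (toℕ i)                     ≡⟨ fromIsJust-just _ (isJust-att H e i) ⟩
  just (attach H e i)                 ≡⟨ cong just (Vec.lookup∘tabulate (attach H e) i) ⟨
  just (lookup (Vec.tabulate (attach H e)) i) ∎
  where
  open ≡-Reasoning
  i = fromℕ< σ<k

attOf-injective : ∀ {X : Set} (e e' : Edge X) → proj₁ e ≡ proj₁ e' → (∀ σ → attOf e σ ≡ attOf e' σ) → e ≡ e'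
attOf-injective (l , xs) (.l , ys) refl eq = cong (l ,_)
  (trans (sym (Vec.tabulate∘lookup xs)) (trans (Vec.tabulate-cong lem) (Vec.tabulate∘lookup ys)))
  where
  attOf-toℕ : ∀ xs i → attOf (l , xs) (toℕ i) ≡ just (lookup xs i)
  attOf-toℕ xs i with toℕ i <? proj₁ l
  ... | yes i<k = cong (just ∘ lookup xs) (fromℕ<-toℕ i i<k)
  ... | no i≮k  = ⊥-elim (i≮k (toℕ<n i))
  lem : ∀ i → lookup xs i ≡ lookup ys i
  lem i = just-injective (trans (sym (attOf-toℕ xs i)) (trans (eq (toℕ i)) (attOf-toℕ ys i)))

hyperedge-map : (H K : Hyp) → ∀ e e' (g : Fin (nV H) → Fin (nV K)) → lab K e' ≡ lab H e →
                (∀ σ → att K e' σ ≡ Maybe.map g (att H e σ)) → hyperedge K e' ≡ mapE g (hyperedge H e)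
hyperedge-map H K e e' g l a = attOf-injective _ _ l λ σ → begin
  attOf (hyperedge K e') σ               ≡⟨ att-attOf K e' σ ⟨
  att K e' σ                             ≡⟨ a σ ⟩
  Maybe.map g (att H e σ)                ≡⟨ cong (Maybe.map g) (att-attOf H e σ) ⟩
  Maybe.map g (attOf (hyperedge H e) σ)  ≡⟨ attOf-map g (hyperedge H e) σ ⟨
  attOf (mapE g (hyperedge H e)) σ       ∎
  where open ≡-Reasoning

fromEdges : ∀ {V E} → (Fin E → Edge (Fin V)) → (ext : ℕ → Maybe (Fin V)) → FiniteSet (is-just ∘ ext) → Hyp
fromEdges {V} {E} es x fin = record
  { nV = V ; nE = E ; lab = proj₁ ∘ es ; att = attOf ∘ es ; att-dom = attOf-dom ∘ es ; ext = x ; ext-fin = fin }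

hyperedge-fromEdges : ∀ {V E} (es : Fin E → Edge (Fin V)) x fin e → hyperedge (fromEdges es x fin) e ≡ es e
hyperedge-fromEdges es x fin e = attOf-injective _ _ refl λ σ → sym (att-attOf (fromEdges es x fin) e σ)

-- Names of nodes

External : ∀ {T} (H : Hypergraph T) → Fin (nV H) → Set
External H v = ∃ λ σ → ext H σ ≡ just v

external? : ∀ {T} (H : Hypergraph T) v → Dec (External H v)
external? H v with any? {n = proj₁ (ext-fin H)} (λ i → ≡-dec _≟_ (ext H (toℕ i)) (just v))
... | yes (i , e) = yes (toℕ i , e)
... | no ¬e = no λ (σ , e) → ¬e (fromℕ< (ext<fin H e) , trans (cong (ext H) (toℕ-fromℕ< _)) e)

-- External nodes are named by one of their selectors; h sends each selector to the chosen one.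
record Naming {T} (H : Hypergraph T) : Set where
  field
    size    : ℕ
    ν       : Fin (nV H) → Term size
    h       : ℕ → ℕ
    ν-ext   : ∀ {σ v} → ext H σ ≡ just v → ν v ≡ free (h σ)
    ν-free  : ∀ {v s} → ν v ≡ free s → ext H s ≡ just v
    h-out   : ∀ {σ} → ext H σ ≡ nothing → h σ ≡ σ
    node    : Fin size → Fin (nV H)
    ν-node  : ∀ i → ν (node i) ≡ bound i
    ν-bound : ∀ {v i} → ν v ≡ bound i → v ≡ node i

free-injective : ∀ {n x y} → free {n} x ≡ free y → x ≡ y
free-injective refl = refl

bound-injective : ∀ {n} {i j : Fin n} → bound i ≡ bound j → i ≡ j
bound-injective refl = refl

abstract
  naming : ∀ {T} (H : Hypergraph T) → Naming H
  naming H = record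
    { size = size ; ν = ν ; h = λ σ → h σ (ext H σ)
    ; ν-ext = λ {σ} {v} e → trans (ν-ext' (σ , e)) (cong (λ m → free (h σ m)) (sym e))
    ; ν-free = ν-free
    ; h-out = λ {σ} e → cong (h σ) e
    ; node = emb ; ν-node = ν-node ; ν-bound = ν-bound }
    where
    open Listing (listing (λ v → ¬? (external? H v)))
    ν : Fin (nV H) → Term size
    ν v with external? H v
    ... | yes (σ , _) = free σ
    ... | no ¬e       = bound (proj₁ (index v ¬e))
    choice : Fin (nV H) → ℕ
    choice v with external? H v
    ... | yes (σ , _) = σ
    ... | no _        = 0
    h : ℕ → Maybe (Fin (nV H)) → ℕ
    h σ (just v) = choice v
    h σ nothing  = σ
    ν-ext' : ∀ {v} → External H v → ν v ≡ free (choice v)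
    ν-ext' {v} x with external? H v
    ... | yes _ = refl
    ... | no ¬e = ⊥-elim (¬e x)
    ν-free : ∀ {v s} → ν v ≡ free s → ext H s ≡ just v
    ν-free {v} eq with external? H v
    ν-free refl | yes (σ , e) = e
    ν-node : ∀ i → ν (emb i) ≡ bound i
    ν-node i with external? H (emb i)
    ... | yes e = ⊥-elim (emb-P i e)
    ... | no ¬e = cong bound (emb-inj (proj₂ (index _ ¬e)))
    ν-bound : ∀ {v i} → ν v ≡ bound i → v ≡ emb i
    ν-bound {v} eq with external? H v
    ν-bound refl | no ¬e = sym (proj₂ (index _ ¬e))

module N {T} (H : Hypergraph T) where
  open Naming (naming H) public

  h-cong : ∀ {σ τ v} → ext H σ ≡ just v → ext H τ ≡ just v → h σ ≡ h τ
  h-cong e e' = free-injective (trans (sym (ν-ext e)) (ν-ext e'))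

  -- `h σ` is a selector of the same node as `σ`, or `σ` itself if `σ` is not external, so `k`
  -- cannot tell the two apart.
  h-retract : ∀ (k : ℕ → ℕ) → (∀ {σ τ v} → ext H σ ≡ just v → ext H τ ≡ just v → k σ ≡ k τ) → ∀ σ → k (h σ) ≡ k σ
  h-retract k resp σ with ext H σ in e
  ... | nothing = cong k (h-out e)
  ... | just v  = resp (ν-free (ν-ext e)) e

  h-idem : ∀ σ → h (h σ) ≡ h σ
  h-idem = h-retract h h-cong

  node-internal : ∀ {i} → ¬ External H (node i)
  node-internal {i} (σ , e) with () ← trans (sym (ν-node i)) (ν-ext e)

  node-injective : ∀ {i j} → node i ≡ node j → i ≡ j
  node-injective {i} {j} e = bound-injective (trans (sym (ν-node i)) (trans (cong ν e) (ν-node j)))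

  internal : ∀ v → ¬ External H v → ∃ λ i → ν v ≡ bound i
  internal v ¬x with ν v in e
  ... | free s  = ⊥-elim (¬x (s , ν-free e))
  ... | bound i = i , refl

  -- Every node is external or listed by `node`, so values on selectors and on internal nodes
  -- determine `Φ`. Morphisms out of `state H` obtain their `edge≡` from this.
  ν-factor : ∀ {n} (Φ : Fin (nV H) → Term n) γ π → (∀ {σ v} → ext H σ ≡ just v → Φ v ≡ free (γ σ)) →
             (∀ i → Φ (node i) ≡ bound (π i)) → ∀ v → Φ v ≡ tmap γ π (ν v)
  ν-factor Φ γ π e e' v with ν v in eq
  ... | free s  = e (ν-free eq)
  ... | bound i = trans (cong Φ (ν-bound eq)) (e' i)

state : Hyp → State
state H = record { nI = N.size H ; nEd = nE H ; edge = mapE (N.ν H) ∘ hyperedge H }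

∅ : Fin 0 → ℕ
∅ ()

-- A name of `A` outside `type(H)` denotes no node of `H`; `N.h H` keeps it, and later renamings may
-- still fuse it with other names.
U : Formula 0 → Hyp → Set
U A H = Forces A (N.h H) ∅ (state H)

-- Gluing relates external nodes only, so distinct nodes are identified only if both are external.
-- Internal nodes therefore remain internal and distinct under `Sub` and `Par`.
closure-external : ∀ {X : Set} {R : X → X → Set} (E : X → Set) → (∀ {x y} → R x y → E x × E y) →
                   ∀ {x y} → EqClosure R x y → x ≡ y ⊎ (E x × E y)
closure-external {X} E step = EC.fold
  (record { refl = inj₁ refl ; sym = sym' ; trans = trans' }) (inj₂ ∘ step)
  where
  _≈_ : X → X → Set
  x ≈ y = x ≡ y ⊎ (E x × E y)
  sym' : ∀ {x y} → x ≈ y → y ≈ x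
  sym' (inj₁ e)       = inj₁ (sym e)
  sym' (inj₂ (a , b)) = inj₂ (b , a)
  trans' : ∀ {x y z} → x ≈ y → y ≈ z → x ≈ z
  trans' (inj₁ refl) s = s
  trans' (inj₂ r) (inj₁ refl) = inj₂ r
  trans' (inj₂ (a , _)) (inj₂ (_ , b)) = inj₂ (a , b)

-- Substitution and parallel composition on states

module _ {f : ℕ → ℕ} {H K : Hyp} (S : Sub f H K) where
  open Sub S

  sub-ker : ∀ {x y} → g x ≡ g y → x ≡ y ⊎ (External H x × External H y)
  sub-ker e = closure-external (External H) (λ { (glue σ τ a b e e' _) → (σ , e) , (τ , e') })
    (Equivalence.to (g-ker _ _) e)

  sub-internal : ∀ v → ¬ External H v → ¬ External K (g v)
  sub-internal v ¬x (ρ , e) with ext-dom ρ _ e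
  ... | σ , refl , v₀ , e₀ with sub-ker (just-injective (trans (sym (ext-img σ v₀ e₀)) e))
  ... | inj₁ refl    = ¬x (σ , e₀)
  ... | inj₂ (_ , x) = ¬x x

  -- A node with selector `σ` in `H` has selector `f σ` in `K`, where the chosen name is
  -- `N.h K (f σ)`.
  sub-mor : Mor (N.h K ∘ f) (state H) (state K)
  sub-mor = record
    { π = proj₁ ∘ image ; π-inj = inj ; κ = k
    ; edge≡ = λ e → trans (cong (mapE (N.ν K)) (hyperedge-map H K e _ g (lab-pres e) (att-pres e)))
        (trans (mapE-fuse (N.ν-factor H (N.ν K ∘ g) (N.h K ∘ f) (proj₁ ∘ image)
          (λ e → N.ν-ext K (ext-img _ _ e)) (proj₂ ∘ image)) (hyperedge H e)) (mapE-∘ _ _ (hyperedge H e))) }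
    where
    image : ∀ i → ∃ λ j → N.ν K (g (N.node H i)) ≡ bound j
    image i = N.internal K _ (sub-internal _ (N.node-internal H))
    inj : ∀ {i j} → proj₁ (image i) ≡ proj₁ (image j) → i ≡ j
    inj {i} {j} e with sub-ker (trans (N.ν-bound K (proj₂ (image i)))
                         (trans (cong (N.node K) e) (sym (N.ν-bound K (proj₂ (image j))))))
    ... | inj₁ e'      = N.node-injective H e'
    ... | inj₂ (x , _) = ⊥-elim (N.node-internal H x)

  sub-U : ∀ A {ε} → U A H → Forces A (N.h K ∘ f) ε (state K)
  sub-U A = Forces-mor A sub-mor (λ x _ → N.h-retract H (N.h K ∘ f)
    (λ e e' → N.h-cong K (ext-img _ _ e) (ext-img _ _ e')) x) (λ ())

-- An isomorphism is a substitution along `id`, which reduces closure under isomorphism to closure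
-- under `sub`.
iso-sub : ∀ {H K : Hyp} → Iso H K → Sub id H K
iso-sub {H} {K} I = record
  { g = V.to ; g-surj = λ v → V.from v , V.strictlyInverseˡ v
  ; g-ker = λ x y → mk⇔
      (λ e → subst (EqClosure _ x) (trans (sym (V.strictlyInverseʳ x)) (trans (cong V.from e) (V.strictlyInverseʳ y))) (EC.reflexive _))
      (EC.gfold isEquivalence V.to λ { (glue σ .σ a b e e' refl) → cong V.to (just-injective (trans (sym e) e')) })
  ; k = fE ; lab-pres = lab-pres ; att-pres = att-pres
  ; ext-img = λ σ v e → trans (ext-pres σ) (cong (Maybe.map V.to) e)
  ; ext-dom = λ ρ w e → let v , e' , _ = map-just⁻ (ext H ρ) (trans (sym (ext-pres ρ)) e) in ρ , refl , v , e' }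
  where
  open Iso I
  module V = Inverse fV

module _ {H₁ H₂ K : Hyp} (P : Par H₁ H₂ K) where
  open Par P

  External⊎ : Fin (nV H₁) ⊎ Fin (nV H₂) → Set
  External⊎ = [ External H₁ , External H₂ ]

  par-ker : ∀ {x y} → g x ≡ g y → x ≡ y ⊎ (External⊎ x × External⊎ y)
  par-ker e = closure-external External⊎ (λ { (glue σ a b e e') → (σ , e) , (σ , e') })
    (Equivalence.to (g-ker _ _) e)

  par-external : ∀ {σ v} → ext K σ ≡ just v →
                 (∃ λ a → ext H₁ σ ≡ just a × g (inj₁ a) ≡ v) ⊎ (∃ λ b → ext H₂ σ ≡ just b × g (inj₂ b) ≡ v)
  par-external {σ} e with ext H₁ σ in e₁ | ext H₂ σ in e₂
  ... | just a  | _       = inj₁ (a , refl , just-injective (trans (sym (ext₁ σ a e₁)) e))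
  ... | nothing | just b  = inj₂ (b , refl , just-injective (trans (sym (ext₂ σ b e₂)) e))
  ... | nothing | nothing = ⊥-elim (just≢nothing e (extN σ e₁ e₂))

  par-internal : ∀ x → ¬ External⊎ x → ¬ External K (g x)
  par-internal x ¬x (σ , e) with par-external e
  ... | inj₁ (a , e₁ , eq) with par-ker eq
  ...   | inj₁ refl    = ¬x (σ , e₁)
  ...   | inj₂ (_ , x) = ¬x x
  par-internal x ¬x (σ , e) | inj₂ (b , e₂ , eq) with par-ker eq
  ...   | inj₁ refl    = ¬x (σ , e₂)
  ...   | inj₂ (_ , x) = ¬x x

  nodes : Fin (N.size H₁) ⊎ Fin (N.size H₂) → Fin (nV H₁) ⊎ Fin (nV H₂)
  nodes (inj₁ i) = inj₁ (N.node H₁ i)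
  nodes (inj₂ i) = inj₂ (N.node H₂ i)

  nodes-internal : ∀ i → ¬ External⊎ (nodes i)
  nodes-internal (inj₁ i) = N.node-internal H₁
  nodes-internal (inj₂ i) = N.node-internal H₂

  nodes-injective : ∀ {i j} → nodes i ≡ nodes j → i ≡ j
  nodes-injective {inj₁ i} {inj₁ j} e = cong inj₁ (N.node-injective H₁ (inj₁-injective e))
  nodes-injective {inj₂ i} {inj₂ j} e = cong inj₂ (N.node-injective H₂ (inj₂-injective e))

  -- Both factors pass to the names chosen in `K`; as `Join` renames only its first factor, the
  -- second is renamed beforehand.
  par-join : Join (N.h K) (state H₁) (rename (N.h K) (state H₂)) (state K)
  par-join = record
    { π = proj₁ ∘ image ; π-inj = inj ; κ = k
    ; edge₁≡ = λ e → trans (cong (mapE (N.ν K)) (hyperedge-map H₁ K e _ (g ∘ inj₁) (lab₁ e) (att₁ e)))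
        (trans (mapE-fuse (N.ν-factor H₁ (N.ν K ∘ g ∘ inj₁) (N.h K) (proj₁ ∘ image ∘ inj₁)
          (λ e → N.ν-ext K (ext₁ _ _ e)) (proj₂ ∘ image ∘ inj₁)) (hyperedge H₁ e)) (mapE-∘ _ _ (hyperedge H₁ e)))
    ; edge₂≡ = λ e → trans (cong (mapE (N.ν K)) (hyperedge-map H₂ K e _ (g ∘ inj₂) (lab₂ e) (att₂ e)))
        (trans (mapE-fuse (N.ν-factor H₂ (N.ν K ∘ g ∘ inj₂) (N.h K) (proj₁ ∘ image ∘ inj₂)
          (λ e → N.ν-ext K (ext₂ _ _ e)) (proj₂ ∘ image ∘ inj₂)) (hyperedge H₂ e))
        (trans (mapE-∘ _ _ (hyperedge H₂ e)) (sym (mapE-fuse (tmap-∘ _ _ _ _) _)))) }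
    where
    image : ∀ i → ∃ λ j → N.ν K (g (nodes i)) ≡ bound j
    image i = N.internal K _ (par-internal (nodes i) (nodes-internal i))
    inj : ∀ {i j} → proj₁ (image i) ≡ proj₁ (image j) → i ≡ j
    inj {i} {j} e with par-ker (trans (N.ν-bound K (proj₂ (image i)))
                         (trans (cong (N.node K) e) (sym (N.ν-bound K (proj₂ (image j))))))
    ... | inj₁ e'      = nodes-injective e'
    ... | inj₂ (x , _) = ⊥-elim (nodes-internal i x)

  par-U₁ : ∀ A {ε} → U A H₁ → Forces A (N.h K) ε (rename (N.h K) (state H₁))
  par-U₁ A = Forces-mor A (mor-rename _ _) (λ x _ → N.h-retract H₁ (N.h K) (λ e e' → N.h-cong K (ext₁ _ _ e) (ext₁ _ _ e')) x) (λ ())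

  par-U₂ : ∀ A {ε} → U A H₂ → Forces A (N.h K) ε (rename (N.h K) (state H₂))
  par-U₂ A = Forces-mor A (mor-rename _ _) (λ x _ → N.h-retract H₂ (N.h K) (λ e e' → N.h-cong K (ext₂ _ _ e) (ext₂ _ _ e')) x) (λ ())

  U-⊗⁺ : ∀ A B → U A H₁ → U B H₂ → U (A ⊗ B) K
  U-⊗⁺ A B a b = _ , _ , join-rename par-join , par-U₁ A a , par-U₂ B b

  U-⊸⁻ : ∀ A B → U (A ⊸ B) H₁ → U A H₂ → U B K
  U-⊸⁻ A B f a = Forces-mor B {id} mor-id (λ x _ → h-K x) (λ ()) (f (N.h K) _ (state K) par-join
      (Forces-mor A mor-id (λ x _ → sym (h-K x)) (λ ()) (par-U₂ A {∅} a)))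
    where
    h-K : ∀ x → N.h K (N.h H₁ x) ≡ N.h K x
    h-K x = N.h-retract H₁ (N.h K) (λ e e' → N.h-cong K (ext₁ _ _ e) (ext₁ _ _ e')) x

-- Quantifiers in the canonical model

state-retract : ∀ (H : Hyp) γ γ' → (∀ {v s} → N.ν H v ≡ free s → γ s ≡ γ' s) → Mor γ (state H) (rename γ' (state H))
state-retract H γ γ' e = record { π = id ; π-inj = id ; κ = ↔-id _
  ; edge≡ = λ j → trans (mapE-fuse lem (hyperedge H j)) (mapE-∘ _ _ (hyperedge H j)) }
  where
  lem : ∀ v → tmap γ' id (N.ν H v) ≡ tmap γ id (N.ν H v)
  lem v with N.ν H v in eq
  ... | free s  = cong free (sym (e eq))
  ... | bound i = refl

mor-trans-id : ∀ {γ S S'} → Mor γ S (rename id S') → Mor γ S S'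
mor-trans-id {S' = S'} m = record { π = π ; π-inj = π-inj ; κ = κ
  ; edge≡ = λ j → trans (sym (mapE-id tmap-id (edge S' _))) (edge≡ j) }
  where open Mor m

h-mor : ∀ H → Mor (N.h H) (state H) (state H)
h-mor H = mor-trans-id (state-retract H (N.h H) id λ {v} e → sym (free-injective (trans (sym e) (N.ν-ext H (N.ν-free H e)))))

-- A forcing witness `y` need not be a chosen name, while the instance at `y` speaks about
-- `N.h H y`; the endomorphism `h-mor` replaces the former by the latter.
U-∃ : ∀ A H → U (ex A) H ⇔ (∃ λ y → U (inst A y) H)
U-∃ A H = mk⇔
  (λ (y , a) → y , Equivalence.from (Forces-inst A y {N.h H} {∅} {∅})
     (Forces-mor A (h-mor H) (λ x _ → N.h-idem H x) (λ { zero → refl }) a))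
  (λ (y , a) → N.h H y , Equivalence.to (Forces-inst A y {N.h H} {∅} {∅}) a)

U-∀ : ∀ A H → U (all A) H ⇔ (∀ y → U (inst A y) H)
U-∀ A H = mk⇔
  (λ a y → Equivalence.from (Forces-inst A y {N.h H} {∅} {∅}) (Forces-mor A (rename-id _) (λ _ _ → refl) (λ { zero → refl }) (a id (N.h H y))))
  -- The instance at a fresh selector `z` is generic: following it by `γ [ z ↦ y ]` yields the
  -- instance at `y` under the later renaming `γ`.
  (λ a γ y → Forces-mor A (state-retract H (γ [ z ↦ y ]) γ (λ e → ↦-other γ z y (ext≢z (N.ν-free H e))))
     (λ x x∈A → ↦-other γ z y (h≢z x x∈A))
     (λ { zero → trans (cong (γ [ z ↦ y ]) (N.h-out H ext-z)) (↦-same γ z y) })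
     (Equivalence.to (Forces-inst A z {N.h H} {∅} {∅}) (a z)))
  where
  rename-id : ∀ S → Mor id (rename id S) S
  rename-id S = mor-trans-id (record { π = id ; π-inj = id ; κ = ↔-id _ ; edge≡ = λ j → sym (mapE-id tmap-id _) })
  -- Above the names of `A` and outside `type(H)`, so `z` differs from every name of a node and from
  -- every `N.h H x` with `x` free in `A`.
  z = boundF A ⊔ proj₁ (ext-fin H)
  ext-z : ext H z ≡ nothing
  ext-z = is-just-false _ (proj₂ (ext-fin H) z (m≤n⊔m (boundF A) _))
  ext≢z : ∀ {s v} → ext H s ≡ just v → s ≢ z
  ext≢z e refl = just≢nothing e ext-z
  h≢z : ∀ x → FreeIn x A → N.h H x ≢ z
  h≢z x x∈A with ext H x in e
  ... | just v  = ext≢z (N.ν-free H (N.ν-ext H e))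
  ... | nothing = λ eq → <⇒≱ (free<bound x∈A) (subst (boundF A ≤_) (trans (sym eq) (N.h-out H e)) (m≤m⊔n _ _))

-- Tensor: splitting a hypergraph along a join

-- The part of H spanned by a state S₁ joined into it and a decidable set P of nodes
-- containing the external nodes and the internal nodes of S₁.
module Part (H : Hyp) (S₁ : State) (π : Fin (nI S₁) → Fin (N.size H)) (π-inj : ∀ {i j} → π i ≡ π j → i ≡ j)
            (κ : Fin (nEd S₁) → Fin (nE H)) (κ≡ : ∀ j → edge (state H) (κ j) ≡ mapE (tmap id π) (edge S₁ j))
            {P : Fin (nV H) → Set} (P? : ∀ v → Dec (P v)) (P-ext : ∀ v → External H v → P v)
            (P-π : ∀ i → P (N.node H (π i))) where
  open Listing (listing P?) public

  restrict : (m : Maybe (Fin (nV H))) → (∀ v → m ≡ just v → P v) → Maybe (Fin size)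
  restrict (just v) p = just (proj₁ (index v (p v refl)))
  restrict nothing  p = nothing

  map-restrict : ∀ m p → Maybe.map emb (restrict m p) ≡ m
  map-restrict (just v) p = cong just (proj₂ (index v (p v refl)))
  map-restrict nothing  p = refl

  is-just-restrict : ∀ m p → is-just (restrict m p) ≡ is-just m
  is-just-restrict (just v) p = refl
  is-just-restrict nothing  p = refl

  edges : ∀ j → ∃ λ e → mapE emb e ≡ hyperedge H (κ j)
  edges j = mapE-section (hyperedge H (κ j)) (edge S₁ j) (κ≡ j) λ
    { v (free s) e  → index v (P-ext v (s , N.ν-free H e))
    ; v (bound i) e → index v (subst P (sym (N.ν-bound H e)) (P-π i)) }

  part : Hyp
  part = fromEdges (proj₁ ∘ edges) (λ σ → restrict (ext H σ) λ v e → P-ext v (σ , e))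
    (proj₁ (ext-fin H) , λ σ b≤σ → trans (is-just-restrict (ext H σ) _) (proj₂ (ext-fin H) σ b≤σ))

  map-emb-ext : ∀ σ → Maybe.map emb (ext part σ) ≡ ext H σ
  map-emb-ext σ = map-restrict (ext H σ) _

  hyperedge-part : ∀ j → mapE emb (hyperedge part j) ≡ hyperedge H (κ j)
  hyperedge-part j = trans (cong (mapE emb) (hyperedge-fromEdges (proj₁ ∘ edges) (ext part) (ext-fin part) j)) (proj₂ (edges j))

  att-part : ∀ j σ → att H (κ j) σ ≡ Maybe.map emb (att part j σ)
  att-part j σ = trans (att-attOf H (κ j) σ) (trans (cong (λ e → attOf e σ) (sym (hyperedge-part j)))
    (trans (attOf-map emb (hyperedge part j) σ) (cong (Maybe.map emb) (sym (att-attOf part j σ)))))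

  ext⁺ : ∀ {σ v} → ext H σ ≡ just v → ∃ λ a → ext part σ ≡ just a × emb a ≡ v
  ext⁺ {σ} e = map-just⁻ (ext part σ) (trans (map-emb-ext σ) e)

  ext⁻ : ∀ {σ a} → ext part σ ≡ just a → ext H σ ≡ just (emb a)
  ext⁻ {σ} e = trans (sym (map-emb-ext σ)) (cong (Maybe.map emb) e)

  extN : ∀ {σ} → ext H σ ≡ nothing → ext part σ ≡ nothing
  extN {σ} e with ext part σ in eq
  ... | just _  = ⊥-elim (just≢nothing (ext⁻ eq) e)
  ... | nothing = refl

  ext-emb : ∀ {σ a} → ext H σ ≡ just (emb a) → ext part σ ≡ just a
  ext-emb e with ext⁺ e
  ... | a , e' , eq with refl ← emb-inj eq = e'

  internal-part : ∀ i → ∃ λ j → ∃ λ a → emb a ≡ N.node H (π i) × N.ν part a ≡ bound j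
  internal-part i =
    let a , e = index _ (P-π i)
        j , e' = N.internal part a λ (σ , x) → N.node-internal H (σ , trans (ext⁻ x) (cong just e))
    in j , a , e , e'

  part-mor : Mor (N.h part) S₁ (state part)
  part-mor = record { π = proj₁ ∘ internal-part ; π-inj = inj ; κ = ↔-id _
    ; edge≡ = λ j → mapE-transfer {f = N.ν H ∘ emb} {g = tmap id π} (hyperedge part j) (edge S₁ j)
        (trans (mapE-∘ (N.ν H) emb (hyperedge part j)) (trans (cong (mapE (N.ν H)) (hyperedge-part j)) (κ≡ j))) λ
        { a (free s) e  → N.ν-ext part (ext-emb (N.ν-free H e))
        ; a (bound i) e → let j , a' , e₁ , e₂ = internal-part i in
            trans (cong (N.ν part) (emb-inj (trans (N.ν-bound H e) (sym e₁)))) e₂ } }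
    where
    inj : ∀ {i j} → proj₁ (internal-part i) ≡ proj₁ (internal-part j) → i ≡ j
    inj {i} {j} e = let _ , _ , e₁ , e₂ = internal-part i ; _ , _ , e₁' , e₂' = internal-part j in
      π-inj (N.node-injective H (trans (sym e₁) (trans (cong emb (trans (N.ν-bound part e₂)
        (trans (cong (N.node part) e) (sym (N.ν-bound part e₂'))))) e₁')))
  part-U : ∀ A → Forces A (N.h H) ∅ S₁ → U A part
  part-U A = Forces-mor A part-mor (λ x _ → N.h-retract H (N.h part) respects x) (λ ())
    where
    respects : ∀ {σ τ v} → ext H σ ≡ just v → ext H τ ≡ just v → N.h part σ ≡ N.h part τ
    respects e e' with ext⁺ e
    ... | a , e₁ , refl = N.h-cong part e₁ (ext-emb e')

-- Both parts keep every external node with all its selectors, so gluing identifies the two copies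
-- again; each internal node lies in exactly one part. Joint injectivity of `π` keeps the internal
-- nodes of `S₁` out of the second part.
U-⊗⁻ : ∀ A B H → U (A ⊗ B) H → (U A ∥ U B) H
U-⊗⁻ A B H (S₁ , S₂ , J , a , b) = P₁.part , P₂.part , P₁.part-U A a , P₂.part-U B b , record
  { g = g
  ; g-surj = surj
  ; g-ker = λ x y → mk⇔ (ker x y)
      (EC.gfold isEquivalence g λ { (glue σ a b e e') → just-injective (trans (sym (P₁.ext⁻ e)) (P₂.ext⁻ e')) })
  ; k = κ
  ; lab₁ = λ e → sym (cong proj₁ (P₁.hyperedge-part e))
  ; lab₂ = λ e → sym (cong proj₁ (P₂.hyperedge-part e))
  ; att₁ = P₁.att-part ; att₂ = P₂.att-part
  ; ext₁ = λ _ _ → P₁.ext⁻ ; ext₂ = λ _ _ → P₂.ext⁻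
  ; extN = λ σ → extN' σ }
  where
  open Join J
  -- The internal nodes used by the second factor; all other internal nodes go to the first.
  Second : Fin (nV H) → Set
  Second v = ∃ λ j → v ≡ N.node H (π (inj₂ j))
  second? : ∀ v → Dec (Second v)
  second? v = any? (λ j → v ≟ N.node H (π (inj₂ j)))
  disjoint : ∀ i → ¬ Second (N.node H (π (inj₁ i)))
  disjoint i (j , e) with () ← π-inj (N.node-injective H e)
  external-first : ∀ v → External H v → ¬ Second v
  external-first _ x (j , refl) = N.node-internal H x
  module P₁ = Part H S₁ (π ∘ inj₁) (inj₁-injective ∘ π-inj) (Inverse.to κ ∘ inj₁) edge₁≡
    (¬? ∘ second?) external-first disjoint
  module P₂ = Part H S₂ (π ∘ inj₂) (inj₂-injective ∘ π-inj) (Inverse.to κ ∘ inj₂) edge₂≡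
    (λ v → external? H v ⊎-dec second? v) (λ v → inj₁) (λ i → inj₂ (i , refl))
  g : Fin P₁.size ⊎ Fin P₂.size → Fin (nV H)
  g = [ P₁.emb , P₂.emb ]
  surj : ∀ v → ∃ λ x → g x ≡ v
  surj v with second? v
  ... | yes s = let b , e = P₂.index v (inj₂ s) in inj₂ b , e
  ... | no ¬s = let a , e = P₁.index v ¬s in inj₁ a , e
  cross : ∀ a b → P₁.emb a ≡ P₂.emb b → ParGlue P₁.part P₂.part (inj₁ a) (inj₂ b)
  cross a b e with P₂.emb-P b
  ... | inj₂ s       = ⊥-elim (P₁.emb-P a (subst Second (sym e) s))
  ... | inj₁ (σ , x) = glue σ a b (P₁.ext-emb (trans x (cong just (sym e)))) (P₂.ext-emb x)
  ker : ∀ x y → g x ≡ g y → EqClosure (ParGlue P₁.part P₂.part) x y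
  ker (inj₁ a) (inj₁ a') e with refl ← P₁.emb-inj e = EC.reflexive _
  ker (inj₁ a) (inj₂ b)  e = EC.return (cross a b e)
  ker (inj₂ b) (inj₁ a)  e = EC.symmetric _ (EC.return (cross a b (sym e)))
  ker (inj₂ b) (inj₂ b') e with refl ← P₂.emb-inj e = EC.reflexive _
  extN' : ∀ σ → ext P₁.part σ ≡ nothing → ext P₂.part σ ≡ nothing → ext H σ ≡ nothing
  extN' σ e _ = trans (sym (P₁.map-emb-ext σ)) (cong (Maybe.map P₁.emb) e)

-- Linear implication: realising states as hypergraphs

Eventually : (ℕ → Set) → Set
Eventually Q = ∃ λ b → ∀ M → b ≤ M → Q M

-- A state stores no bound on its names; as it has finitely many hyperedges, the bounds for each of
-- them have a maximum.
eventually-∀ : ∀ {n} {Q : Fin n → ℕ → Set} → (∀ i → Eventually (Q i)) → Eventually (λ M → ∀ i → Q i M)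
eventually-∀ {zero}  q = 0 , λ _ _ ()
eventually-∀ {suc n} q with q zero | eventually-∀ (q ∘ suc)
... | b , q₀ | c , qₛ = b ⊔ c , λ { M le zero    → q₀ M (≤-trans (m≤m⊔n b c) le)
                                  ; M le (suc i) → qₛ M (≤-trans (m≤n⊔m b c) le) i }

-- The first `M` nodes stand for the names below `M`, the other `m` for the internal nodes.
decode : ∀ M {m} → Fin (M + m) → Term m
decode M w = [ free ∘ toℕ , bound ] (splitAt M w)

decode-name : ∀ M {m} (ρ : Fin M) → decode M {m} (ρ ↑ˡ m) ≡ free (toℕ ρ)
decode-name M {m} ρ = cong [ free ∘ toℕ , bound ] (splitAt-↑ˡ M ρ m)

decode-bound : ∀ M {m} (i : Fin m) → decode M (M ↑ʳ i) ≡ bound i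
decode-bound M {m} i = cong [ free ∘ toℕ , bound ] (splitAt-↑ʳ M m i)

decode-name⁻ : ∀ M {m} (w : Fin (M + m)) {ρ} → decode M w ≡ free ρ → ∃ λ (ρ<M : ρ < M) → w ≡ fromℕ< ρ<M ↑ˡ m
decode-name⁻ M w e with splitAt M w in eq
decode-name⁻ M {m} w refl | inj₁ i = toℕ<n i , trans (sym (splitAt⁻¹-↑ˡ eq)) (cong (_↑ˡ m) (sym (fromℕ<-toℕ i _)))

decode-bound⁻ : ∀ M {m} (w : Fin (M + m)) {i} → decode M w ≡ bound i → w ≡ M ↑ʳ i
decode-bound⁻ M w e with splitAt M w in eq
decode-bound⁻ M w refl | inj₂ i = sym (splitAt⁻¹-↑ʳ eq)

decodable : ∀ {m} (e : Edge (Term m)) → Eventually λ M → ∃ λ e' → mapE (decode M {m}) e' ≡ e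
decodable {m} (l , ts) = let b , q = vec ts in b , λ M b≤M → let ws , e = q M b≤M in (l , ws) , cong (l ,_) e
  where
  term : (t : Term m) → Eventually λ M → ∃ λ w → decode M {m} w ≡ t
  term (free x)  = suc x , λ M x<M → fromℕ< x<M ↑ˡ m , trans (decode-name M (fromℕ< x<M)) (cong free (toℕ-fromℕ< x<M))
  term (bound i) = 0 , λ M _ → M ↑ʳ i , decode-bound M i
  vec : ∀ {k} (ts : Vec (Term m) k) → Eventually λ M → ∃ λ ws → Vec.map (decode M {m}) ws ≡ ts
  vec []       = 0 , λ _ _ → [] , refl
  vec (t ∷ ts) with term t | vec ts
  ... | b , q | c , r = b ⊔ c , λ M le →
    let w  , e  = q M (≤-trans (m≤m⊔n b c) le)
        ws , es = r M (≤-trans (m≤n⊔m b c) le)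
    in w ∷ ws , cong₂ _∷_ e es

-- The state S as a hypergraph: a selector σ < b denotes the node β σ, and the
-- remaining nodes free ρ are exposed under the fresh selectors b + ρ.
module Realise (S : State) (β : ℕ → ℕ) (b : ℕ) where
  enough : Eventually λ M → (∀ j → ∃ λ e → mapE (decode M) e ≡ edge S j)
  enough = eventually-∀ (λ j → decodable (edge S j))

  enough' : Eventually λ M → ∀ (i : Fin b) → β (toℕ i) < M
  enough' = eventually-∀ (λ i → suc (β (toℕ i)) , λ _ → id)

  M : ℕ
  M = proj₁ enough ⊔ proj₁ enough'

  β<M : ∀ {σ} → σ < b → β σ < M
  β<M σ<b = subst (λ σ → β σ < M) (toℕ-fromℕ< σ<b) (proj₂ enough' M (m≤n⊔m (proj₁ enough) _) (fromℕ< σ<b))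

  edges : ∀ j → ∃ λ e → mapE (decode M) e ≡ edge S j
  edges = proj₂ enough M (m≤m⊔n _ _)

  δ : ℕ → ℕ
  δ σ with σ <? b
  ... | yes _ = β σ
  ... | no _  = σ ∸ b

  δ-< : ∀ {σ} → σ < b → δ σ ≡ β σ
  δ-< {σ} σ<b with σ <? b
  ... | yes _   = refl
  ... | no σ≮b = ⊥-elim (σ≮b σ<b)

  δ-≥ : ∀ {σ} → b ≤ σ → δ σ ≡ σ ∸ b
  δ-≥ {σ} b≤σ with σ <? b
  ... | yes σ<b = ⊥-elim (<⇒≱ σ<b b≤σ)
  ... | no _    = refl

  δ-+ : ∀ ρ → δ (b + ρ) ≡ ρ
  δ-+ ρ = trans (δ-≥ (m≤m+n b ρ)) (m+n∸m≡n b ρ)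

  nodeOf : ℕ → Maybe (Fin (M + nI S))
  nodeOf ρ with ρ <? M
  ... | yes ρ<M = just (fromℕ< ρ<M ↑ˡ nI S)
  ... | no _    = nothing

  nodeOf⁻ : ∀ {ρ w} → nodeOf ρ ≡ just w → decode M w ≡ free ρ
  nodeOf⁻ {ρ} e with ρ <? M
  nodeOf⁻ refl | yes ρ<M = trans (decode-name M (fromℕ< ρ<M)) (cong free (toℕ-fromℕ< ρ<M))

  nodeOf⁺ : ∀ {ρ w} → decode M w ≡ free ρ → nodeOf ρ ≡ just w
  nodeOf⁺ {ρ} {w} e with decode-name⁻ M w e
  ... | ρ<M , refl with ρ <? M
  ...   | yes _   = refl
  ...   | no ρ≮M = ⊥-elim (ρ≮M ρ<M)

  realised : Hyp
  realised = fromEdges (proj₁ ∘ edges) (nodeOf ∘ δ) (b + M , fin)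
    where
    fin : ∀ σ → b + M ≤ σ → is-just (nodeOf (δ σ)) ≡ false
    fin σ le with δ σ <? M
    ... | no _    = refl
    ... | yes δ<M = ⊥-elim (<⇒≱ δ<M (subst₂ _≤_ (m+n∸m≡n b M) (sym (δ-≥ (≤-trans (m≤m+n b M) le))) (∸-monoˡ-≤ b le)))

  ext⁺ : ∀ {ρ w} → decode M w ≡ free ρ → ext realised (b + ρ) ≡ just w
  ext⁺ {ρ} e = trans (cong nodeOf (δ-+ ρ)) (nodeOf⁺ e)

  ext-β : ∀ {σ} → σ < b → ∃ λ w → ext realised σ ≡ just w × ext realised (b + β σ) ≡ just w
  ext-β {σ} σ<b = w , trans (cong nodeOf (δ-< σ<b)) (nodeOf⁺ e) , ext⁺ e
    where
    w = fromℕ< (β<M σ<b) ↑ˡ nI S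
    e : decode M w ≡ free (β σ)
    e = trans (decode-name M _) (cong free (toℕ-fromℕ< (β<M σ<b)))

  hyperedge-realised : ∀ j → mapE (decode M) (hyperedge realised j) ≡ edge S j
  hyperedge-realised j = trans (cong (mapE _) (hyperedge-fromEdges (proj₁ ∘ edges) (ext realised) (ext-fin realised) j)) (proj₂ (edges j))

  ↑ʳ-internal : ∀ i → ¬ External realised (M ↑ʳ i)
  ↑ʳ-internal i (σ , e) with () ← trans (sym (decode-bound M i)) (nodeOf⁻ {δ σ} e)

  -- A name `ρ` need not be of the form `β σ`, so the morphism goes through the fresh selector
  -- `b + ρ`. For `σ < b`, the selectors `σ` and `b + β σ` share a node by `ext-β`, which lets
  -- `realised-U` recover `β`.
  realised-mor : Mor (λ ρ → N.h realised (b + ρ)) S (state realised)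
  realised-mor = record { π = proj₁ ∘ image ; π-inj = inj ; κ = ↔-id _
    ; edge≡ = λ j → trans (mapE-cong factor (hyperedge realised j))
        (trans (mapE-∘ _ _ (hyperedge realised j)) (cong (mapE _) (hyperedge-realised j))) }
    where
    image : ∀ i → ∃ λ j → N.ν realised (M ↑ʳ i) ≡ bound j
    image i = N.internal realised (M ↑ʳ i) (↑ʳ-internal i)
    inj : ∀ {i j} → proj₁ (image i) ≡ proj₁ (image j) → i ≡ j
    inj {i} {j} e = bound-injective (trans (sym (decode-bound M i)) (trans (cong (decode M) same) (decode-bound M j)))
      where
      same : M ↑ʳ i ≡ M ↑ʳ j
      same = trans (N.ν-bound realised (proj₂ (image i))) (trans (cong (N.node realised) e) (sym (N.ν-bound realised (proj₂ (image j)))))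
    factor : ∀ w → N.ν realised w ≡ tmap (λ ρ → N.h realised (b + ρ)) (proj₁ ∘ image) (decode M w)
    factor w with decode M w in e
    ... | free ρ  = N.ν-ext realised (ext⁺ e)
    ... | bound i = trans (cong (N.ν realised) (decode-bound⁻ M w e)) (proj₂ (image i))

  realised-U : ∀ A {ε} → boundF A ≤ b → Forces A β ε S → U A realised
  realised-U A A≤b = Forces-mor A realised-mor (λ x x∈A → let w , e , e' = ext-β (≤-trans (free<bound x∈A) A≤b) in N.h-cong realised e' e) (λ ())

module _ (A B : Formula 0) (H : Hyp) (f : ∀ H' K → U A H' → Par H H' K → U B K)
         (γ : ℕ → ℕ) (S' S'' : State) (J : Join γ (state H) S' S'') (a : Forces A (γ ∘ N.h H) (γ ∘ ∅) S') where
  private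
    module J = Join J
    b = proj₁ (ext-fin H)
    -- The fresh selectors of the realisation start at `bnd`, beyond the selectors of `H` and the
    -- names of `A` and `B`.
    bnd = boundF A ⊔ (boundF B ⊔ b)
    open Realise S' (γ ∘ N.h H) bnd
    R = realised
    K = proj₁ (par-exists H R)
    P = proj₂ (par-exists H R)
    open Par P

    ext<bnd : ∀ {σ v} → ext H σ ≡ just v → σ < bnd
    ext<bnd e = ≤-trans (ext<fin H e) (≤-trans (m≤n⊔m (boundF B) b) (m≤n⊔m (boundF A) _))

    B≤bnd : boundF B ≤ bnd
    B≤bnd = ≤-trans (m≤m⊔n (boundF B) b) (m≤n⊔m (boundF A) _)

    -- The term of `S''` that a node denotes. It respects gluing because the selectors of `H` lie
    -- below `bnd`, where `δ` is `γ ∘ N.h H`.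
    Φ : Fin (nV H) ⊎ Fin (nV R) → Term (nI S'')
    Φ (inj₁ v) = tmap γ (J.π ∘ inj₁) (N.ν H v)
    Φ (inj₂ w) = tmap id (J.π ∘ inj₂) (decode M w)

    Φ₁-ext : ∀ {σ v} → ext H σ ≡ just v → Φ (inj₁ v) ≡ free (δ σ)
    Φ₁-ext e = trans (cong (tmap _ _) (N.ν-ext H e)) (cong free (sym (δ-< (ext<bnd e))))

    Φ₂-ext : ∀ {σ w} → ext R σ ≡ just w → Φ (inj₂ w) ≡ free (δ σ)
    Φ₂-ext {σ} e = cong (tmap _ _) (nodeOf⁻ {δ σ} e)

    Φ-cong : ∀ {x y} → g x ≡ g y → Φ x ≡ Φ y
    Φ-cong e = EC.gfold isEquivalence Φ (λ { (glue σ a b e e') → trans (Φ₁-ext e) (sym (Φ₂-ext e')) })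
      (Equivalence.to (g-ker _ _) e)

    Φ-ext : ∀ {σ x} → ext K σ ≡ just (g x) → Φ x ≡ free (δ σ)
    Φ-ext e with par-external P e
    ... | inj₁ (a , e₁ , eq) = trans (sym (Φ-cong eq)) (Φ₁-ext e₁)
    ... | inj₂ (b , e₂ , eq) = trans (sym (Φ-cong eq)) (Φ₂-ext e₂)

    -- The reason for exposing the names of `R` under fresh selectors: a node of `K` that denotes a
    -- name has to be external, so that `K-mor` can send internal nodes to internal nodes.
    Φ-free : ∀ x {s} → Φ x ≡ free s → External K (g x)
    Φ-free (inj₁ v) e with N.ν H v in eq
    ... | free s = s , ext₁ _ _ (N.ν-free H eq)
    Φ-free (inj₂ w) e with decode M w in eq
    ... | free ρ = bnd + ρ , ext₂ _ _ (ext⁺ eq)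

    inner : Fin (N.size H) ⊎ Fin (nI S') → Fin (nV H) ⊎ Fin (nV R)
    inner (inj₁ i) = inj₁ (N.node H i)
    inner (inj₂ i) = inj₂ (M ↑ʳ i)

    Φ-bound : ∀ x {q} → Φ x ≡ bound q → ∃ λ i → x ≡ inner i × J.π i ≡ q
    Φ-bound (inj₁ v) e with N.ν H v in eq
    ... | bound i = inj₁ i , cong inj₁ (N.ν-bound H eq) , bound-injective e
    Φ-bound (inj₂ w) e with decode M w in eq
    ... | bound i = inj₂ i , cong inj₂ (decode-bound⁻ M w eq) , bound-injective e

    Φ-injective : ∀ x y {q} → Φ x ≡ bound q → Φ y ≡ bound q → x ≡ y
    Φ-injective x y e e' with Φ-bound x e | Φ-bound y e'
    ... | i , refl , p | j , refl , p' = cong inner (J.π-inj (trans p (sym p')))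

    pre : Fin (nV K) → Fin (nV H) ⊎ Fin (nV R)
    pre v = proj₁ (g-surj v)

    g-pre : ∀ v → g (pre v) ≡ v
    g-pre v = proj₂ (g-surj v)

    image : ∀ j → ∃ λ q → Φ (pre (N.node K j)) ≡ bound q
    image j with Φ (pre (N.node K j)) in eq
    ... | free s  = ⊥-elim (N.node-internal K (subst (External K) (g-pre _) (Φ-free _ eq)))
    ... | bound q = q , refl

    factor : ∀ x → Φ x ≡ tmap δ (proj₁ ∘ image) (N.ν K (g x))
    factor x = trans (Φ-cong (sym (g-pre (g x)))) (N.ν-factor K (Φ ∘ pre) δ (proj₁ ∘ image)
      (λ {σ} {v} e → Φ-ext (trans e (cong just (sym (g-pre v))))) (proj₂ ∘ image) (g x))

    edge-K : ∀ c → edge S'' (Inverse.to J.κ c) ≡ mapE (tmap δ (proj₁ ∘ image)) (edge (state K) (Inverse.to k c))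
    edge-K (inj₁ j) = begin
      _ ≡⟨ J.edge₁≡ j ⟩
      _ ≡⟨ mapE-fuse (λ v → factor (inj₁ v)) (hyperedge H j) ⟩
      _ ≡⟨ mapE-∘ _ (N.ν K ∘ g ∘ inj₁) (hyperedge H j) ⟩
      _ ≡⟨ cong (mapE _) (mapE-∘ (N.ν K) (g ∘ inj₁) (hyperedge H j)) ⟩
      _ ≡⟨ cong (mapE _ ∘ mapE (N.ν K)) (hyperedge-map H K j _ (g ∘ inj₁) (lab₁ j) (att₁ j)) ⟨
      _ ∎
      where open ≡-Reasoning
    edge-K (inj₂ j) = begin
      _ ≡⟨ J.edge₂≡ j ⟩
      _ ≡⟨ cong (mapE _) (hyperedge-realised j) ⟨
      _ ≡⟨ mapE-fuse (λ w → factor (inj₂ w)) (hyperedge R j) ⟩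
      _ ≡⟨ mapE-∘ _ (N.ν K ∘ g ∘ inj₂) (hyperedge R j) ⟩
      _ ≡⟨ cong (mapE _) (mapE-∘ (N.ν K) (g ∘ inj₂) (hyperedge R j)) ⟩
      _ ≡⟨ cong (mapE _ ∘ mapE (N.ν K)) (hyperedge-map R K j _ (g ∘ inj₂) (lab₂ j) (att₂ j)) ⟨
      _ ∎
      where open ≡-Reasoning

    K-mor : Mor δ (state K) S''
    K-mor = record { π = proj₁ ∘ image ; π-inj = inj ; κ = J.κ ↔-∘ ↔-sym k
      ; edge≡ = λ e → trans (edge-K (Inverse.from k e)) (cong (mapE _ ∘ edge (state K)) (Inverse.strictlyInverseˡ k e)) }
      where
      inj : ∀ {i j} → proj₁ (image i) ≡ proj₁ (image j) → i ≡ j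
      inj {i} {j} e = N.node-injective K (trans (sym (g-pre _)) (trans (cong g
        (Φ-injective _ _ (proj₂ (image i)) (trans (proj₂ (image j)) (cong bound (sym e))))) (g-pre _)))

    δ-resp : ∀ {σ τ v} → ext K σ ≡ just v → ext K τ ≡ just v → δ σ ≡ δ τ
    δ-resp {v = v} e e' = free-injective (trans (sym (Φ-ext (trans e v≡))) (Φ-ext (trans e' v≡)))
      where v≡ = cong just (sym (g-pre v))

  -- Gluing `H` to `R` performs `γ`: external nodes of `H` whose names `γ` equates meet in one node
  -- of `R`. Thus `f` gives `B` on the composite `K`, and `K-mor` carries it to `S''`.
  U-⊸⁺ : Forces B (γ ∘ N.h H) (γ ∘ ∅) S''
  U-⊸⁺ = Forces-mor B K-mor
    (λ x x∈B → trans (N.h-retract K δ δ-resp x) (δ-< (≤-trans (free<bound x∈B) B≤bnd))) (λ ())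
    (f R K (realised-U A (m≤m⊔n _ _) a) P)

-- Completeness

canonicalModel : Model canonical
canonicalModel = record
  { u = U
  ; iso-closed = λ A I a → Forces-mor A mor-id (λ _ _ → refl) (λ ()) (sub-U (iso-sub I) A {∅} a)
  ; sub-incl = λ h A a S → Equivalence.from (Forces-ren A h) (sub-U S A {∅} a)
  ; u-⊗ = λ A B H → mk⇔ (U-⊗⁻ A B H) (λ (_ , _ , a , b , P) → U-⊗⁺ P A B a b)
  ; u-⊸ = λ A B H → mk⇔ (λ f H' K a P → U-⊸⁻ P A B f a) (λ f γ S' S'' J a → U-⊸⁺ A B H f γ S' S'' J a)
  ; u-∃ = U-∃
  ; u-∀ = U-∀ }

-- Hypotheses are moved to the right by ⊸, semantically through `u-⊸` and back by a cut, until only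
-- truth at `K₀` has to be read off.
⊨⇒⊢ : ∀ Γ {B} → All ImpAll Γ → ImpAll B → ⊨ canonicalModel Γ B → Γ ⊢ B
-- `K₀` has no hyperedges, so its context is empty under any assignment; the constant 0 is an
-- arbitrary one.
⊨⇒⊢ [] {B} [] b t = ⊢-subst (sub₂-id B) (Forces⇒⊢ b Forces-B id (λ _ → 0))
  where
  Forces-B : Forces B id ∅ (state K₀)
  Forces-B = Forces-mor B mor-id (λ x _ → N.h-out K₀ refl) (λ ()) (t K₀ (K₀-empty {canonical}))
⊨⇒⊢ (A ∷ Γ) {B} (a ∷ as) b t = exch (++-comm Γ (A ∷ [])) (cut-⊸
  (⊨⇒⊢ Γ as (⊸I a b) λ H x → Equivalence.from (u-⊸ canonicalModel A B H) λ H' K y P → t K (H' , H , y , x , par-comm P)) ax)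

theorem35 : (∀ (T : Alphabet) (M : Model T) Γ B → Γ ⊢ B → TrueIn M Γ B)
            × (∀ Γ B → All ImpAll Γ → ImpAll B → (∀ (T : Alphabet) (M : Model T) → TrueIn M Γ B) → Γ ⊢ B)
theorem35 = soundness , λ Γ B as b t → ⊨⇒⊢ Γ as b λ H x → t canonical canonicalModel H (uCtx₀⇒uCtx canonicalModel Γ H x)
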